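{- Let $\mathcal{D}=\prod_{r=1}^d\mathcal{D}_r$ be a product distribution on $\{0,1\}^d$, where $\mu_r$ is the probability that $\mathcal{D}_r$ assigns to $0$, and let $\varepsilon\le 1/10$. Any monotonicity tester with respect to $\mathcal{D}$ with proximity parameter $\varepsilon$ for functions $f:\{0,1\}^d\to\mathbb{N}$ must make $\Omega\big(\sum_{r=1}^d\min(\mu_r,1-\mu_r)\big)$ queries.
   Context: $f$ is monotone if $f(x)\le f(y)$ whenever $x\le y$ coordinatewise. A monotonicity tester w.r.t. $\mathcal{D}$ with proximity parameter $\varepsilon$ (possibly adaptive, two-sided error) accepts monotone $f$ with probability $>2/3$ and rejects with probability $>2/3$ every $f$ with $\min_{g\text{ monotone}}\Pr_{x\sim\mathcal{D}}[f(x)\ne g(x)]>\varepsilon$. -}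

module Defs where

open import Level using (Level; _⊔_; suc)
open import Algebra.Bundles using (CommutativeRing; Semiring; RawSemiring)
open import Algebra.Core using (Op₁; Op₂)
import Algebra.Construct.NaturalChoice.Min as Min
import Algebra.Definitions
import Algebra.Definitions.RawSemiring as RawSemiringDefs
open import Algebra.Structures using (IsCommutativeRing)
open import Data.Bool using (Bool; true; false; if_then_else_; not)
import Data.Bool as Bool
open import Data.Fin using (Fin)
open import Data.List using (List; []; _∷_; _++_; map; foldr)
open import Data.Nat as ℕ using (ℕ)
open import Data.Product using (_×_)
open import Data.Vec using (Vec; []; _∷_; lookup)
open import Data.Vec.Relation.Binary.Pointwise.Inductive using (Pointwise)
open import Relation.Binary using (Rel; IsTotalOrder; TotalOrder)
import Relation.Binary.Construct.NonStrictToStrict as ToStrict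
open import Relation.Nullary using (¬_; does)

-- The library has no real numbers.  Probabilities take values in an arbitrary
-- (totally) ordered field, of which ℝ is the intended instance.
record OrderedField (c ℓ₁ ℓ₂ : Level) : Set (suc (c ⊔ ℓ₁ ⊔ ℓ₂)) where
  infix  8 -_
  infixl 7 _*_
  infixl 6 _+_
  infix  4 _≈_ _≤_
  field
    Carrier           : Set c
    _≈_               : Rel Carrier ℓ₁
    _≤_               : Rel Carrier ℓ₂
    _+_ _*_           : Op₂ Carrier
    -_                : Op₁ Carrier
    0# 1#             : Carrier
    isCommutativeRing : IsCommutativeRing _≈_ _+_ _*_ -_ 0# 1#
    isTotalOrder      : IsTotalOrder _≈_ _≤_
    0≉1               : ¬ (0# ≈ 1#)
    ≉0⇒invertible     : ∀ {x} → ¬ (x ≈ 0#) →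
                        Algebra.Definitions.Invertible _≈_ 1# _*_ x
    +-monoˡ-≤         : ∀ z {x y} → x ≤ y → x + z ≤ y + z
    *-nonneg          : ∀ {x y} → 0# ≤ x → 0# ≤ y → 0# ≤ x * y

  commutativeRing : CommutativeRing c ℓ₁
  commutativeRing = record { isCommutativeRing = isCommutativeRing }

  totalOrder : TotalOrder c ℓ₁ ℓ₂
  totalOrder = record { isTotalOrder = isTotalOrder }

  open CommutativeRing commutativeRing public using (_-_; semiring)
  private
    rawSemiring : RawSemiring c ℓ₁
    rawSemiring = Semiring.rawSemiring semiring

  open ToStrict _≈_ _≤_ public using (_<_)
  open Min totalOrder public using (_⊓_)
  open RawSemiringDefs rawSemiring public using (sum; product)

  fromℕ : ℕ → Carrier
  fromℕ n = RawSemiringDefs._×_ rawSemiring n 1#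

  InUnitInterval : Carrier → Set ℓ₂
  InUnitInterval p = 0# ≤ p × p ≤ 1#

-- false and true encode the coordinates 0 and 1.
Cube : ℕ → Set
Cube d = Vec Bool d

points : ∀ d → List (Cube d)
points ℕ.zero    = [] ∷ []
points (ℕ.suc d) = map (false ∷_) (points d) ++ map (true ∷_) (points d)

Monotone : ∀ {d} → (Cube d → ℕ) → Set
Monotone f = ∀ {x y} → Pointwise Bool._≤_ x y → f x ℕ.≤ f y

module Testing {c ℓ₁ ℓ₂} (F : OrderedField c ℓ₁ ℓ₂) where
  open OrderedField F

  -- A product distribution on the cube is given by μ : Fin d → Carrier, where
  -- μ r is the probability that coordinate r equals 0.

  mass : ∀ {d} → (Fin d → Carrier) → Cube d → Carrier
  mass μ x = product (λ r → if lookup x r then 1# - μ r else μ r)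

  Prob : ∀ {d} → (Fin d → Carrier) → (Cube d → Bool) → Carrier
  Prob {d} μ P =
    foldr _+_ 0# (map (λ x → if P x then mass μ x else 0#) (points d))

  disagreement : ∀ {d} → (Fin d → Carrier) → (f g : Cube d → ℕ) → Carrier
  disagreement μ f g = Prob μ (λ x → not (does (f x ℕ.≟ g x)))

  -- The minimum of disagreement μ f g over monotone g exceeds ε.  (It is a
  -- minimum: disagreement μ f takes only finitely many values.)
  FarFromMonotone : ∀ {d} → (Fin d → Carrier) → Carrier → (Cube d → ℕ) →
                    Set (ℓ₁ ⊔ ℓ₂)
  FarFromMonotone μ ε f = ∀ g → Monotone g → ε < disagreement μ f g

  -- Randomized adaptive algorithms making at most q queries on every run, as
  -- decision trees with coin tosses of arbitrary bias.
  data Algorithm (d : ℕ) : ℕ → Set (c ⊔ ℓ₂) where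
    output : ∀ {q} → (accept? : Bool) → Algorithm d q
    toss   : ∀ {q} (p : Carrier) → InUnitInterval p →
             (heads tails : Algorithm d q) → Algorithm d q
    query  : ∀ {q} → Cube d → (ℕ → Algorithm d q) → Algorithm d (ℕ.suc q)

  -- outputProb A f b is the probability that A, run on f, outputs b.
  outputProb : ∀ {d q} → Algorithm d q → (Cube d → ℕ) → Bool → Carrier
  outputProb (output b′)      f b = if does (b′ Bool.≟ b) then 1# else 0#
  outputProb (toss p _ A₁ A₂) f b =
    p * outputProb A₁ f b + (1# - p) * outputProb A₂ f b
  outputProb (query x k)      f b = outputProb (k (f x)) f b

  -- x > 2/3, with the denominator cleared.
  ExceedsTwoThirds : Carrier → Set (ℓ₁ ⊔ ℓ₂)
  ExceedsTwoThirds x = fromℕ 2 < fromℕ 3 * x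

  record IsMonotonicityTester {d q} (μ : Fin d → Carrier) (ε : Carrier)
                              (A : Algorithm d q) : Set (c ⊔ ℓ₁ ⊔ ℓ₂) where
    field
      accepts : ∀ f → Monotone f → ExceedsTwoThirds (outputProb A f true)
      rejects : ∀ f → FarFromMonotone μ ε f →
                ExceedsTwoThirds (outputProb A f false)

  Σmin : ∀ {d} → (Fin d → Carrier) → Carrier
  Σmin μ = sum (λ r → μ r ⊓ (1# - μ r))

-- A family of monotone functions that hides the order of its digits.  Let s be
-- a complete binary tree of depth d whose nodes carry labels in {0, …, K - 1},
-- and let f(x) be the number in base K + 1 whose i-th digit is s(x₁ … xᵢ₋₁) + xᵢ.
-- Replacing xᵢ by 1 - xᵢ in this formula for all i in a block B of coordinates
-- reverses the order between the all-v point of a fibre over B and the rest of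
-- the fibre (v = 0 or 1), so the result is far from monotone as soon as that
-- point has probability between 1/4 and 1/2.
--
-- An algorithm no two of whose queries are separated by B, meaning that they
-- first differ at a coordinate in B, sees at most one child of every node on a
-- level in B.  Its acceptance probability, as a function of the digits i and j at
-- the two children, is therefore of the form L(i) + R(j), and summing over the
-- label a the difference between (i, j) = (a, a + 1) and (a + 1, a) telescopes:
-- swapping a node costs O(1/K), and with K of order 2^d all nodes can be swapped.
-- Hence a tester must separate two queries by B with constant probability.  But
-- each query adds at most one coordinate at which queries separate, so q is at
-- least a constant times the number of disjoint blocks.  Greedily packing the
-- coordinates for which v has probability at least 1/2 gives, for v = 0 and v = 1
-- together, a number of blocks linear in Σ min(μ_r, 1 - μ_r).

module Submission where

open import Defs
import Algebra.Properties.AbelianGroup as AbelianGroupProperties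
import Algebra.Properties.Ring as RingProperties
import Algebra.Properties.Semiring.Mult as SemiringMult
import Algebra.Solver.Ring as RingSolver
open import Algebra.Bundles using (CommutativeRing; RawRing)
open import Algebra.Solver.Ring.AlmostCommutativeRing
  using (fromCommutativeRing; _-Raw-AlmostCommutative⟶_)
open import Data.Bool as Bool using (Bool; true; false; if_then_else_; not; _∧_; _∨_; T)
open import Data.Bool.ListAction using (any)
import Data.Bool.Properties as Bool
open import Data.Empty using (⊥; ⊥-elim)
open import Data.Fin as Fin using (Fin; toℕ)
import Data.Fin.Properties as Fin
open import Data.List using (List; []; _∷_; _++_; filter; foldr; length; map)
import Data.List.Properties as List
open import Data.List.Membership.Propositional using (_∈_; find)
open import Data.List.Relation.Unary.All as All using (All; []; _∷_)
import Data.List.Relation.Unary.All.Properties as All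
open import Data.List.Relation.Unary.AllPairs as AllPairs using (AllPairs; []; _∷_)
import Data.List.Relation.Unary.AllPairs.Properties as AllPairs
open import Data.List.Relation.Unary.Any using (here; there)
import Data.List.Relation.Unary.Any.Properties as Any
open import Data.Maybe using (just; nothing)
open import Data.Nat as ℕ using (ℕ; zero; suc)
import Data.Nat.Properties as ℕ
open import Data.Product using (_×_; _,_; ∃₂; proj₁; proj₂)
open import Data.Product.Properties using (≡-dec)
open import Data.Sum as Sum using (_⊎_; inj₁; inj₂)
open import Data.Unit using (tt)
open import Data.Vec using (Vec; []; _∷_; replicate)
open import Data.Vec.Properties using (∷-injectiveˡ; ∷-injectiveʳ)
open import Data.Vec.Relation.Binary.Pointwise.Inductive using (Pointwise; []; _∷_)
open import Function using (_∘_)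
import Level
open import Relation.Binary using (IsTotalOrder; WeaklyDecidable)
open import Relation.Binary.PropositionalEquality as ≡ using (_≡_)
import Relation.Binary.Reasoning.Setoid as SetoidReasoning
open import Relation.Nullary using (¬_; does; no; yes)

-- Ring normalisation with integer coefficients, represented as formal
-- differences (a , b) of naturals.
module IntegerCoefficients {c ℓ} (R : CommutativeRing c ℓ) where
  open CommutativeRing R
  open SemiringMult semiring using (×-homo-+; ×1-homo-*) renaming (_×_ to _·_)
  open AbelianGroupProperties +-abelianGroup using (⁻¹-∙-comm; ⁻¹-involutive; ε⁻¹≈ε)
  open RingProperties ring using (-‿distribˡ-*; -‿distribʳ-*)
  open SetoidReasoning setoid

  Coefficient : Set
  Coefficient = ℕ × ℕ

  -- The solver compares normal forms syntactically, so coefficients have to be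
  -- kept in lowest terms.
  reduce : Coefficient → Coefficient
  reduce (a , b) = a ℕ.∸ b , b ℕ.∸ a

  coefficients : RawRing _ _
  coefficients = record
    { Carrier = Coefficient
    ; _≈_ = _≡_
    ; _+_ = λ { (a , b) (a′ , b′) → reduce (a ℕ.+ a′ , b ℕ.+ b′) }
    ; _*_ = λ { (a , b) (a′ , b′) → reduce (a ℕ.* a′ ℕ.+ b ℕ.* b′ , a ℕ.* b′ ℕ.+ b ℕ.* a′) }
    ; -_ = λ { (a , b) → b , a }
    ; 0# = 0 , 0
    ; 1# = 1 , 0
    }

  private
    numeral : ℕ → Carrier
    numeral 0 = 0#
    numeral 1 = 1#
    numeral (suc (suc n)) = 1# + numeral (suc n)

    -- The special cases make the numerals 0 and 1 evaluate to 0# and 1#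
    -- definitionally.
    ⟦_⟧ : Coefficient → Carrier
    ⟦ a , 0 ⟧ = numeral a
    ⟦ a , suc b ⟧ = numeral a - numeral (suc b)

    -- The same value as `⟦_⟧`, but uniform in both components: the homomorphism laws are proved for
    -- it and then carried over.
    difference : Coefficient → Carrier
    difference (a , b) = a · 1# - b · 1#

    numeral≈· : ∀ n → numeral n ≈ n · 1#
    numeral≈· 0 = refl
    numeral≈· 1 = sym (+-identityʳ 1#)
    numeral≈· (suc (suc n)) = +-congˡ (numeral≈· (suc n))

    ⟦⟧≈difference : ∀ x → ⟦ x ⟧ ≈ difference x
    ⟦⟧≈difference (a , 0) = begin
      numeral a         ≈⟨ numeral≈· a ⟩
      a · 1#            ≈⟨ sym (+-identityʳ _) ⟩
      a · 1# + 0#       ≈⟨ +-congˡ (sym ε⁻¹≈ε) ⟩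
      a · 1# - 0#       ∎
    ⟦⟧≈difference (a , suc b) =
      +-cong (numeral≈· a) (-‿cong (numeral≈· (suc b)))

    interchange : ∀ w x y z → (w + x) + (y + z) ≈ (w + y) + (x + z)
    interchange w x y z = begin
      (w + x) + (y + z)  ≈⟨ +-assoc w x (y + z) ⟩
      w + (x + (y + z))  ≈⟨ +-congˡ (sym (+-assoc x y z)) ⟩
      w + ((x + y) + z)  ≈⟨ +-congˡ (+-congʳ (+-comm x y)) ⟩
      w + ((y + x) + z)  ≈⟨ +-congˡ (+-assoc y x z) ⟩
      w + (y + (x + z))  ≈⟨ sym (+-assoc w y (x + z)) ⟩
      (w + y) + (x + z)  ∎

    difference-pairwise : ∀ a b a′ b′ →
      difference (a ℕ.+ a′ , b ℕ.+ b′) ≈ difference (a , b) + difference (a′ , b′)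
    difference-pairwise a b a′ b′ = begin
      (a ℕ.+ a′) · 1# - (b ℕ.+ b′) · 1#
        ≈⟨ +-cong (×-homo-+ 1# a a′) (-‿cong (×-homo-+ 1# b b′)) ⟩
      (a · 1# + a′ · 1#) - (b · 1# + b′ · 1#)
        ≈⟨ +-congˡ (sym (⁻¹-∙-comm _ _)) ⟩
      (a · 1# + a′ · 1#) + (- (b · 1#) + - (b′ · 1#))
        ≈⟨ interchange _ _ _ _ ⟩
      difference (a , b) + difference (a′ , b′) ∎

    difference-shift : ∀ m n k → difference (k ℕ.+ m , k ℕ.+ n) ≈ difference (m , n)
    difference-shift m n k = begin
      difference (k ℕ.+ m , k ℕ.+ n)           ≈⟨ difference-pairwise k k m n ⟩
      (k · 1# - k · 1#) + difference (m , n)   ≈⟨ +-congʳ (-‿inverseʳ _) ⟩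
      0# + difference (m , n)                  ≈⟨ +-identityˡ _ ⟩
      difference (m , n)                       ∎

    difference-reduce : ∀ a b → difference (reduce (a , b)) ≈ difference (a , b)
    difference-reduce zero zero = refl
    difference-reduce zero (suc b) = refl
    difference-reduce (suc a) zero = refl
    difference-reduce (suc a) (suc b) = trans (difference-reduce a b) (sym (difference-shift a b 1))

    difference-+ : ∀ x y → difference (RawRing._+_ coefficients x y) ≈ difference x + difference y
    difference-+ (a , b) (a′ , b′) = trans (difference-reduce (a ℕ.+ a′) (b ℕ.+ b′))
        (difference-pairwise a b a′ b′)

    product-difference : ∀ w x y z → (w - x) * (y - z) ≈ (w * y + x * z) - (w * z + x * y)
    product-difference w x y z = begin
      (w - x) * (y - z)
        ≈⟨ distribʳ _ _ _ ⟩
      w * (y - z) + - x * (y - z)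
        ≈⟨ +-cong (distribˡ _ _ _) (distribˡ _ _ _) ⟩
      (w * y + w * - z) + (- x * y + - x * - z)
        ≈⟨ +-cong (+-congˡ (sym (-‿distribʳ-* w z)))
                  (+-cong (sym (-‿distribˡ-* x y))
                     (trans (sym (-‿distribˡ-* x (- z)))
                       (trans (-‿cong (sym (-‿distribʳ-* x z))) (⁻¹-involutive _)))) ⟩
      (w * y + - (w * z)) + (- (x * y) + x * z)
        ≈⟨ +-congˡ (+-comm _ _) ⟩
      (w * y + - (w * z)) + (x * z + - (x * y))
        ≈⟨ interchange _ _ _ _ ⟩
      (w * y + x * z) + (- (w * z) + - (x * y))
        ≈⟨ +-congˡ (⁻¹-∙-comm _ _) ⟩
      (w * y + x * z) - (w * z + x * y) ∎

    difference-* : ∀ x y → difference (RawRing._*_ coefficients x y) ≈ difference x * difference y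
    difference-* (a , b) (a′ , b′) = trans (difference-reduce (a ℕ.* a′ ℕ.+ b ℕ.* b′) _) (begin
      (a ℕ.* a′ ℕ.+ b ℕ.* b′) · 1# - (a ℕ.* b′ ℕ.+ b ℕ.* a′) · 1#
        ≈⟨ +-cong (sums a a′ b b′) (-‿cong (sums a b′ b a′)) ⟩
      _ ≈⟨ sym (product-difference _ _ _ _) ⟩
      difference (a , b) * difference (a′ , b′) ∎)
      where
      sums : ∀ m n p q → (m ℕ.* n ℕ.+ p ℕ.* q) · 1# ≈ (m · 1#) * (n · 1#) + (p · 1#) * (q · 1#)
      sums m n p q = trans (×-homo-+ 1# (m ℕ.* n) (p ℕ.* q))
          (+-cong (×1-homo-* m n) (×1-homo-* p q))

    difference-neg : ∀ x → difference (RawRing.-_ coefficients x) ≈ - difference x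
    difference-neg (a , b) = begin
      b · 1# - a · 1#              ≈⟨ +-comm _ _ ⟩
      - (a · 1#) + b · 1#          ≈⟨ +-congˡ (sym (⁻¹-involutive _)) ⟩
      - (a · 1#) + - - (b · 1#)    ≈⟨ ⁻¹-∙-comm _ _ ⟩
      - (a · 1# - b · 1#)          ∎

  morphism : coefficients -Raw-AlmostCommutative⟶ fromCommutativeRing R
  morphism = record
    { ⟦_⟧ = ⟦_⟧
    ; +-homo = λ x y → trans (⟦⟧≈difference (RawRing._+_ coefficients x y))
        (trans (difference-+ x y)
        (sym (+-cong (⟦⟧≈difference x) (⟦⟧≈difference y))))
    ; *-homo = λ x y → trans (⟦⟧≈difference (RawRing._*_ coefficients x y))
        (trans (difference-* x y)
        (sym (*-cong (⟦⟧≈difference x) (⟦⟧≈difference y))))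
    ; -‿homo = λ x → trans (⟦⟧≈difference (RawRing.-_ coefficients x)) (trans (difference-neg x)
        (sym (-‿cong (⟦⟧≈difference x))))
    ; 0-homo = refl
    ; 1-homo = refl
    }

  private
    ⟦⟧-≟ : WeaklyDecidable (λ x y → ⟦ x ⟧ ≈ ⟦ y ⟧)
    ⟦⟧-≟ x y with ≡-dec ℕ._≟_ ℕ._≟_ x y
    ... | yes ≡.refl = just refl
    ... | no _ = nothing

  open RingSolver coefficients (fromCommutativeRing R) morphism ⟦⟧-≟ public

  :0 :1 : ∀ {n} → Polynomial n
  :0 = con (0 , 0)
  :1 = con (1 , 0)

  -- Evaluates to fromℕ k definitionally.
  :ℕ : ∀ {n} → ℕ → Polynomial n
  :ℕ zero = :0
  :ℕ (suc k) = :1 :+ :ℕ k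

-- The hard functions

Mask : ℕ → Set
Mask = Vec Bool

none : ∀ {d} → Mask d
none = replicate _ false

join : ∀ {a} {A : Set a} {d} → (Cube d → A) → (Cube d → A) → Cube (suc d) → A
join f₀ f₁ (false ∷ x) = f₀ x
join f₀ f₁ (true ∷ x) = f₁ x

data Seed (K : ℕ) : ℕ → Set where
  leaf : Seed K 0
  node : ∀ {d} → Fin K → (s₀ s₁ : Seed K d) → Seed K (suc d)

digit : ∀ {K} → Fin K → Bool → ℕ
digit a false = toℕ a
digit a true = suc (toℕ a)

-- The number whose base-(K + 1) digits are those of acc followed by, for each
-- coordinate i, the label of s at the prefix x₁ … xᵢ₋₁ plus xᵢ xor Bᵢ.
hard : ∀ {K d} → ℕ → Seed K d → Mask d → Cube d → ℕ
hard acc leaf [] = λ _ → acc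
hard {K} acc (node a s₀ s₁) (b ∷ B) =
  join (hard (acc ℕ.* suc K ℕ.+ digit a b) s₀ B)
       (hard (acc ℕ.* suc K ℕ.+ digit a (not b)) s₁ B)

digit≤ : ∀ {K} (a : Fin K) b → digit a b ℕ.≤ K
digit≤ a false = ℕ.<⇒≤ (Fin.toℕ<n a)
digit≤ a true = Fin.toℕ<n a

private
  step-lower : ∀ acc K {n m} → (acc ℕ.* suc K ℕ.+ n) ℕ.* m ℕ.≥ acc ℕ.* (suc K ℕ.* m)
  step-lower acc K {n} {m} = ≡.subst (ℕ._≤ (acc ℕ.* suc K ℕ.+ n) ℕ.* m) (ℕ.*-assoc acc (suc K) m)
    (ℕ.*-monoˡ-≤ m (ℕ.m≤m+n (acc ℕ.* suc K) n))

  step-upper : ∀ acc K {n m} → n ℕ.≤ K →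
    suc (acc ℕ.* suc K ℕ.+ n) ℕ.* m ℕ.≤ suc acc ℕ.* (suc K ℕ.* m)
  step-upper acc K {n} {m} n≤K = ≡.subst (suc (acc ℕ.* suc K ℕ.+ n) ℕ.* m ℕ.≤_)
      (ℕ.*-assoc (suc acc) (suc K) m)
    (ℕ.*-monoˡ-≤ m (ℕ.≤-trans (ℕ.s≤s (ℕ.+-monoʳ-≤ (acc ℕ.* suc K) n≤K))
      (ℕ.≤-reflexive (≡.cong suc (ℕ.+-comm (acc ℕ.* suc K) K)))))

hard-lower : ∀ {K d} acc (s : Seed K d) B x → acc ℕ.* suc K ℕ.^ d ℕ.≤ hard acc s B x
hard-lower acc leaf [] [] = ℕ.≤-reflexive (ℕ.*-identityʳ acc)
hard-lower {K} acc (node a s₀ s₁) (b ∷ B) (false ∷ x) = ℕ.≤-trans (step-lower acc K)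
    (hard-lower _ s₀ B x)
hard-lower {K} acc (node a s₀ s₁) (b ∷ B) (true ∷ x) = ℕ.≤-trans (step-lower acc K)
    (hard-lower _ s₁ B x)

-- Every digit is at most `K`, below the base `suc K`, so the digits after `acc` never carry into
-- it.
hard-upper : ∀ {K d} acc (s : Seed K d) B x → hard acc s B x ℕ.< suc acc ℕ.* suc K ℕ.^ d
hard-upper acc leaf [] [] = ℕ.≤-reflexive (≡.sym (ℕ.*-identityʳ (suc acc)))
hard-upper {K} acc (node a s₀ s₁) (b ∷ B) (false ∷ x) = ℕ.≤-trans (hard-upper _ s₀ B x)
    (step-upper acc K (digit≤ a b))
hard-upper {K} acc (node a s₀ s₁) (b ∷ B) (true ∷ x) = ℕ.≤-trans (hard-upper _ s₁ B x)
    (step-upper acc K (digit≤ a (not b)))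

hard-lex : ∀ {K d acc acc′} (s s′ : Seed K d) B x x′ → acc ℕ.< acc′ →
           hard acc s B x ℕ.< hard acc′ s′ B x′
hard-lex {K} {d} {acc} {acc′} s s′ B x x′ acc<acc′ = ℕ.<-≤-trans (hard-upper acc s B x)
  (ℕ.≤-trans (ℕ.*-monoˡ-≤ (suc K ℕ.^ d) acc<acc′) (hard-lower acc′ s′ B x′))

-- At the first coordinate where the points differ both read the same label, the larger point adds
-- one to it, and `hard-lex` settles the comparison whatever digits follow.
hard-monotone : ∀ {K d} acc (s : Seed K d) → Monotone (hard acc s none)
hard-monotone acc leaf [] = ℕ.≤-refl
hard-monotone acc (node a s₀ s₁) {false ∷ _} (Bool.b≤b ∷ x≤y) = hard-monotone _ s₀ x≤y
hard-monotone acc (node a s₀ s₁) {true ∷ _} (Bool.b≤b ∷ x≤y) = hard-monotone _ s₁ x≤y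
hard-monotone {K} acc (node a s₀ s₁) {_ ∷ x} {_ ∷ y} (Bool.f≤t ∷ _) =
  ℕ.<⇒≤ (hard-lex s₀ s₁ none x y (ℕ.+-monoʳ-< (acc ℕ.* suc K) (ℕ.n<1+n (toℕ a))))

-- Inversions within the fibres of a block

data Fibre (v : Bool) : ∀ {d} → Mask d → Cube d → Cube d → Set where
  []      : Fibre v [] [] []
  outside : ∀ {d} {B : Mask d} {x y} z → Fibre v B x y → Fibre v (false ∷ B) (z ∷ x) (z ∷ y)
  inside  : ∀ {d} {B : Mask d} {x y} z → Fibre v B x y → Fibre v (true ∷ B) (v ∷ x) (z ∷ y)

-- In `Fibre v B x y`, `x` is the all-`v` point of the fibre through `y`: its bottom for
-- `v = false`, its top for `v = true`. These functions put the two points in order.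
lower upper : ∀ {a} {A : Set a} → Bool → A → A → A
lower v x y = if v then y else x
upper v x y = if v then x else y

fibre-ordered : ∀ v {d} {B : Mask d} {x y} → Fibre v B x y →
                Pointwise Bool._≤_ (lower v x y) (upper v x y)
fibre-ordered false [] = []
fibre-ordered true [] = []
fibre-ordered false (outside z p) = Bool.b≤b ∷ fibre-ordered false p
fibre-ordered true (outside z p) = Bool.b≤b ∷ fibre-ordered true p
fibre-ordered false (inside false p) = Bool.b≤b ∷ fibre-ordered false p
fibre-ordered false (inside true p) = Bool.f≤t ∷ fibre-ordered false p
fibre-ordered true (inside false p) = Bool.f≤t ∷ fibre-ordered true p
fibre-ordered true (inside true p) = Bool.b≤b ∷ fibre-ordered true p

-- The first coordinate of `B` at which `y` leaves `x` decides: the flip gives the larger digit to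
-- the point with a 0 there, and `hard-lex` does the rest.
fibre-inverted : ∀ v {K d} acc (s : Seed K d) {B x y} → Fibre v B x y →
                 x ≡ y ⊎ hard acc s B (upper v x y) ℕ.< hard acc s B (lower v x y)
fibre-inverted v acc leaf [] = inj₁ ≡.refl
fibre-inverted false acc (node a s₀ s₁) (outside false p) = Sum.map₁ (≡.cong _)
    (fibre-inverted false _ s₀ p)
fibre-inverted false acc (node a s₀ s₁) (outside true p) = Sum.map₁ (≡.cong _)
    (fibre-inverted false _ s₁ p)
fibre-inverted true acc (node a s₀ s₁) (outside false p) = Sum.map₁ (≡.cong _)
    (fibre-inverted true _ s₀ p)
fibre-inverted true acc (node a s₀ s₁) (outside true p) = Sum.map₁ (≡.cong _)
    (fibre-inverted true _ s₁ p)
fibre-inverted false acc (node a s₀ s₁) (inside false p) = Sum.map₁ (≡.cong _)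
    (fibre-inverted false _ s₀ p)
fibre-inverted true acc (node a s₀ s₁) (inside true p) = Sum.map₁ (≡.cong _)
    (fibre-inverted true _ s₁ p)
fibre-inverted false {K} acc (node a s₀ s₁) {B = _ ∷ B} {x = _ ∷ x} {y = _ ∷ y} (inside true p) =
  inj₂ (hard-lex s₁ s₀ B y x (ℕ.+-monoʳ-< (acc ℕ.* suc K) (ℕ.n<1+n (toℕ a))))
fibre-inverted true {K} acc (node a s₀ s₁) {B = _ ∷ B} {x = _ ∷ x} {y = _ ∷ y} (inside false p) =
  inj₂ (hard-lex s₁ s₀ B x y (ℕ.+-monoʳ-< (acc ℕ.* suc K) (ℕ.n<1+n (toℕ a))))

-- Separation of queries

-- The first coordinate at which x and y differ lies in B.
captures : ∀ {d} → Mask d → Cube d → Cube d → Bool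
captures [] [] [] = false
captures (b ∷ B) (false ∷ x) (false ∷ y) = captures B x y
captures (b ∷ B) (false ∷ x) (true ∷ y) = b
captures (b ∷ B) (true ∷ x) (false ∷ y) = b
captures (b ∷ B) (true ∷ x) (true ∷ y) = captures B x y

data Disjoint : ∀ {d} → Mask d → Mask d → Set where
  []  : Disjoint [] []
  _∷_ : ∀ {d} {B B′ : Mask d} {b b′} → b ∧ b′ ≡ false → Disjoint B B′ → Disjoint (b ∷ B) (b′ ∷ B′)

-- Among three points, the two pairs that separate last do so at the same
-- coordinate.
captures-ultrametric : ∀ {d} {B B′ : Mask d} h h′ x → Disjoint B B′ →
  T (captures B h x) → T (captures B′ h′ x) → T (captures B h h′) ⊎ T (captures B′ h h′)
captures-ultrametric [] [] [] [] ()
captures-ultrametric (false ∷ h) (false ∷ h′) (false ∷ x) (_ ∷ D) p q =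
  captures-ultrametric h h′ x D p q
captures-ultrametric (true ∷ h) (true ∷ h′) (true ∷ x) (_ ∷ D) p q =
  captures-ultrametric h h′ x D p q
captures-ultrametric (true ∷ h) (false ∷ h′) (false ∷ x) (_ ∷ D) p q = inj₁ p
captures-ultrametric (false ∷ h) (true ∷ h′) (true ∷ x) (_ ∷ D) p q = inj₁ p
captures-ultrametric (false ∷ h) (true ∷ h′) (false ∷ x) (_ ∷ D) p q = inj₂ q
captures-ultrametric (true ∷ h) (false ∷ h′) (true ∷ x) (_ ∷ D) p q = inj₂ q
captures-ultrametric {B = true ∷ _} {true ∷ _} (false ∷ h) (false ∷ h′) (true ∷ x) (() ∷ D) p q
captures-ultrametric {B = true ∷ _} {true ∷ _} (true ∷ h) (true ∷ h′) (false ∷ x) (() ∷ D) p q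

captures-sym : ∀ {d} (B : Mask d) x y → captures B x y ≡ captures B y x
captures-sym [] [] [] = ≡.refl
captures-sym (b ∷ B) (false ∷ x) (false ∷ y) = captures-sym B x y
captures-sym (b ∷ B) (false ∷ x) (true ∷ y) = ≡.refl
captures-sym (b ∷ B) (true ∷ x) (false ∷ y) = ≡.refl
captures-sym (b ∷ B) (true ∷ x) (true ∷ y) = captures-sym B x y

captures-refl : ∀ {d} (B : Mask d) x → captures B x x ≡ false
captures-refl [] [] = ≡.refl
captures-refl (b ∷ B) (false ∷ x) = captures-refl B x
captures-refl (b ∷ B) (true ∷ x) = captures-refl B x

-- Four functions obtained by choosing independently one of two functions on
-- the left and one of two functions on the right subcube of a node whose
-- coordinate lies in B, the values elsewhere being fixed.
data Square : ∀ {d} → Mask d → (Bool → Bool → Cube d → ℕ) → Set where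
  root  : ∀ {d} {B : Mask d} (f₀ f₁ : Bool → Cube d → ℕ) →
          Square (true ∷ B) (λ i j → join (f₀ i) (f₁ j))
  left  : ∀ {d} {B : Mask d} {b f} → Square B f → (g : Cube d → ℕ) →
          Square (b ∷ B) (λ i j → join (f i j) g)
  right : ∀ {d} {B : Mask d} {b f} → Square B f → (g : Cube d → ℕ) →
          Square (b ∷ B) (λ i j → join g (f i j))

onLeft onRight : ∀ {d} {B : Mask d} {f} → Square B f → Cube d → Bool
onLeft (root _ _) (b ∷ x) = not b
onLeft (left S _) (false ∷ x) = onLeft S x
onLeft (left S _) (true ∷ x) = false
onLeft (right S _) (false ∷ x) = false
onLeft (right S _) (true ∷ x) = onLeft S x
onRight (root _ _) (b ∷ x) = b
onRight (left S _) (false ∷ x) = onRight S x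
onRight (left S _) (true ∷ x) = false
onRight (right S _) (false ∷ x) = false
onRight (right S _) (true ∷ x) = onRight S x

off-left : ∀ {d} {B : Mask d} {f} (S : Square B f) x → onLeft S x ≡ false →
           ∀ {i i′ j} → f i j x ≡ f i′ j x
off-left (root _ _) (true ∷ x) eq = ≡.refl
off-left (left S _) (false ∷ x) eq = off-left S x eq
off-left (left S _) (true ∷ x) eq = ≡.refl
off-left (right S _) (false ∷ x) eq = ≡.refl
off-left (right S _) (true ∷ x) eq = off-left S x eq

off-right : ∀ {d} {B : Mask d} {f} (S : Square B f) x → onRight S x ≡ false →
            ∀ {i j j′} → f i j x ≡ f i j′ x
off-right (root _ _) (false ∷ x) eq = ≡.refl
off-right (left S _) (false ∷ x) eq = off-right S x eq
off-right (left S _) (true ∷ x) eq = ≡.refl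
off-right (right S _) (false ∷ x) eq = ≡.refl
off-right (right S _) (true ∷ x) eq = off-right S x eq

-- Points on different sides first differ at the coordinate of the square's node, which `root`
-- requires to lie in `B`.
sides-captured : ∀ {d} {B : Mask d} {f} (S : Square B f) x y →
                 onLeft S x ≡ true → onRight S y ≡ true → captures B x y ≡ true
sides-captured (root _ _) (false ∷ x) (true ∷ y) p q = ≡.refl
sides-captured (left S _) (false ∷ x) (false ∷ y) p q = sides-captured S x y p q
sides-captured (right S _) (true ∷ x) (true ∷ y) p q = sides-captured S x y p q

not-both-sides : ∀ {d} {B : Mask d} {f} (S : Square B f) x → onLeft S x ≡ true → onRight S x ≡ false
not-both-sides {B = B} S x p with onRight S x in q
... | false = ≡.refl
... | true with () ← ≡.trans (≡.sym (captures-refl B x)) (sides-captured S x x p q)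

-- Query histories and alarms

module _ {d} (B : Mask d) where

  alarm : List (Cube d) → Cube d → Bool
  alarm history x = any (λ h → captures B h x) history

  Quiet : List (Cube d) → Set
  Quiet history = ∀ h h′ → h ∈ history → h′ ∈ history → captures B h h′ ≡ false

  alarm-false : ∀ history x → alarm history x ≡ false → ∀ {h} → h ∈ history → captures B h x ≡ false
  alarm-false (h ∷ history) x eq (here ≡.refl) with captures B h x
  ... | false = ≡.refl
  alarm-false (h ∷ history) x eq (there h∈) with captures B h x
  ... | false = alarm-false history x eq h∈

  quiet-∷ : ∀ {history} x → Quiet history → alarm history x ≡ false → Quiet (x ∷ history)
  quiet-∷ {history} x quiet eq _ _ (here ≡.refl) (here ≡.refl) = captures-refl B x
  quiet-∷ {history} x quiet eq _ _ (here ≡.refl) (there h′∈) = ≡.trans (captures-sym B x _)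
      (alarm-false history x eq h′∈)
  quiet-∷ {history} x quiet eq _ _ (there h∈) (here ≡.refl) = alarm-false history x eq h∈
  quiet-∷ {history} x quiet eq _ _ (there h∈) (there h′∈) = quiet _ _ h∈ h′∈

-- By `captures-ultrametric`, if both blocks separated the query from the history, one of them would
-- already separate two earlier queries.
one-alarm : ∀ {d} {B B′ : Mask d} history x → Disjoint B B′ → Quiet B history → Quiet B′ history →
            alarm B history x ≡ true → alarm B′ history x ≡ true → ⊥
one-alarm {B = B} {B′} history x D quiet quiet′ p q
  with h , h∈ , c ← find (Any.any⁻ _ history (≡.subst T (≡.sym p) tt))
     | h′ , h′∈ , c′ ← find (Any.any⁻ _ history (≡.subst T (≡.sym q) tt))
  with captures-ultrametric h h′ x D c c′
... | inj₁ t = ≡.subst T (quiet _ _ h∈ h′∈) t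
... | inj₂ t = ≡.subst T (quiet′ _ _ h∈ h′∈) t

none-disjoint : ∀ {d} (B : Mask d) → Disjoint none B
none-disjoint [] = []
none-disjoint (b ∷ B) = ≡.refl ∷ none-disjoint B

module LowerBound {c ℓ₁ ℓ₂} (F : OrderedField c ℓ₁ ℓ₂) where
  open OrderedField F renaming (*-nonneg to infixl 7 _*⁺_)
  open Testing F
  open CommutativeRing commutativeRing
    using (refl; sym; trans; +-cong; +-congˡ; +-congʳ; *-congˡ; *-congʳ) renaming (reflexive to ≡⇒≈)
  open IsTotalOrder isTotalOrder
    using (total; antisym; reflexive; ≤-respˡ-≈; ≤-respʳ-≈)
    renaming (refl to ≤-refl; trans to ≤-trans)
  open SemiringMult semiring using (×1-homo-*)
  open IntegerCoefficients commutativeRing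

  -- Ordered fields

  infixl 6 _+⁺_

  _+⁺_ : ∀ {x y} → 0# ≤ x → 0# ≤ y → 0# ≤ x + y
  _+⁺_ {x} {y} 0≤x 0≤y = ≤-trans 0≤y
    (≤-respˡ-≈ (solve 1 (λ y → :0 :+ y := y) refl y) (+-monoˡ-≤ y 0≤x))

  gap : ∀ {x y} → x ≤ y → 0# ≤ y - x
  gap {x} {y} x≤y =
    ≤-respˡ-≈ (solve 1 (λ x → x :- x := :0) refl x) (+-monoˡ-≤ (- x) x≤y)

  -- The pattern for inequalities below: `e` is a nonnegative certificate, and the ring solver
  -- checks the identity.
  ≤-from-gap : ∀ {x y e} → 0# ≤ e → y ≈ x + e → x ≤ y
  ≤-from-gap {x} {y} {e} 0≤e y≈x+e =
    ≤-respˡ-≈ (solve 1 (λ x → :0 :+ x := x) refl x)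
      (≤-respʳ-≈ (trans (solve 2 (λ x e → e :+ x := x :+ e) refl x e) (sym y≈x+e))
        (+-monoˡ-≤ x 0≤e))

  +-mono-≤ : ∀ {x y x′ y′} → x ≤ y → x′ ≤ y′ → x + x′ ≤ y + y′
  +-mono-≤ {x} {y} {x′} {y′} p q = ≤-from-gap (gap p +⁺ gap q)
    (solve 4 (λ x y x′ y′ → y :+ y′ := x :+ x′ :+ ((y :- x) :+ (y′ :- x′))) refl x y x′ y′)

  *-monoˡ-≤ : ∀ {x y z} → 0# ≤ z → x ≤ y → z * x ≤ z * y
  *-monoˡ-≤ {x} {y} {z} p q = ≤-from-gap (p *⁺ gap q)
    (solve 3 (λ x y z → z :* y := z :* x :+ z :* (y :- x)) refl x y z)

  0≤1 : 0# ≤ 1#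
  0≤1 with total 0# 1#
  ... | inj₁ 0≤1 = 0≤1
  ... | inj₂ 1≤0 = ≤-respʳ-≈ (solve 0 ((:0 :- :1) :* (:0 :- :1) := :1) refl) (gap 1≤0 *⁺ gap 1≤0)

  1≰0 : ¬ (1# ≤ 0#)
  1≰0 1≤0 = 0≉1 (antisym 0≤1 1≤0)

  0≤fromℕ : ∀ n → 0# ≤ fromℕ n
  0≤fromℕ zero = ≤-refl
  0≤fromℕ (suc n) = 0≤1 +⁺ 0≤fromℕ n

  ≰⇒< : ∀ {x y} → ¬ (y ≤ x) → x < y
  ≰⇒< {x} {y} y≰x with total x y
  ... | inj₁ x≤y = x≤y , λ x≈y → y≰x (reflexive (sym x≈y))
  ... | inj₂ y≤x = ⊥-elim (y≰x y≤x)

  *-cancelˡ-≤ : ∀ n {x y} → fromℕ (suc n) * x ≤ fromℕ (suc n) * y → x ≤ y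
  *-cancelˡ-≤ n {x} {y} p with total x y
  ... | inj₁ x≤y = x≤y
  ... | inj₂ y≤x = ≤-from-gap (gap p +⁺ 0≤fromℕ n *⁺ gap y≤x)
    (solve 3 (λ n x y → y := x :+ (((:1 :+ n) :* y :- (:1 :+ n) :* x) :+ n :* (x :- y))) refl
        (fromℕ n) x y)

  sum-mono : ∀ {n} {g h : Fin n → Carrier} → (∀ i → g i ≤ h i) → sum g ≤ sum h
  sum-mono {zero} g≤h = ≤-refl
  sum-mono {suc n} g≤h = +-mono-≤ (g≤h Fin.zero) (sum-mono (g≤h ∘ Fin.suc))

  sum-+ : ∀ {n} (g h : Fin n → Carrier) → sum (λ i → g i + h i) ≈ sum g + sum h
  sum-+ {zero} g h = solve 0 (:0 := :0 :+ :0) refl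
  sum-+ {suc n} g h = trans (+-congˡ (sum-+ (g ∘ Fin.suc) (h ∘ Fin.suc)))
    (solve 4 (λ a b c d → (a :+ b) :+ (c :+ d) := (a :+ c) :+ (b :+ d)) refl _ _ _ _)

  sum-const : ∀ n x → sum {n} (λ _ → x) ≈ fromℕ n * x
  sum-const zero x = solve 1 (λ x → :0 := :0 :* x) refl x
  sum-const (suc n) x = trans (+-congˡ (sum-const n x))
    (solve 2 (λ n x → x :+ n :* x := (:1 :+ n) :* x) refl (fromℕ n) x)

  module _ (n : ℕ) where
    private
      suc≉0 : ¬ (fromℕ (suc n) ≈ 0#)
      suc≉0 eq = 1≰0 (≤-respʳ-≈ eq (≤-from-gap (0≤fromℕ n) refl))
      inv = ≉0⇒invertible suc≉0

    reciprocal : Carrier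
    reciprocal = proj₁ inv

    reciprocal-inverse : fromℕ (suc n) * reciprocal ≈ 1#
    reciprocal-inverse = proj₂ (proj₂ inv)

    0≤reciprocal : 0# ≤ reciprocal
    0≤reciprocal = *-cancelˡ-≤ n (≤-respˡ-≈ (solve 1 (λ n → :0 := n :* :0) refl (fromℕ (suc n)))
        (≤-respʳ-≈ (sym reciprocal-inverse) 0≤1))

  ∑ : ∀ {a} {A : Set a} → List A → (A → Carrier) → Carrier
  ∑ xs g = foldr (λ x s → g x + s) 0# xs

  mix-mono : ∀ {p x x′ y y′} → InUnitInterval p → x ≤ x′ → y ≤ y′ →
             p * x + (1# - p) * y ≤ p * x′ + (1# - p) * y′
  mix-mono (0≤p , p≤1) x≤x′ y≤y′ = +-mono-≤ (*-monoˡ-≤ 0≤p x≤x′) (*-monoˡ-≤ (gap p≤1) y≤y′)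

  mix-const : ∀ p x → p * x + (1# - p) * x ≈ x
  mix-const = solve 2 (λ p x → p :* x :+ (:1 :- p) :* x := x) refl

  mix-+ : ∀ p a b c d →
          p * (a + b) + (1# - p) * (c + d) ≈ (p * a + (1# - p) * c) + (p * b + (1# - p) * d)
  mix-+ = solve 5 (λ p a b c d → p :* (a :+ b) :+ (:1 :- p) :* (c :+ d)
    := (p :* a :+ (:1 :- p) :* c) :+ (p :* b :+ (:1 :- p) :* d)) refl

  -- Algorithms stopped when two queries are separated

  outputProb-total : ∀ {d q} (A : Algorithm d q) f → outputProb A f true + outputProb A f false ≈ 1#
  outputProb-total (output true) f = solve 0 (:1 :+ :0 := :1) refl
  outputProb-total (output false) f = solve 0 (:0 :+ :1 := :1) refl
  outputProb-total (toss p _ A₁ A₂) f = trans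
    (sym (mix-+ p _ _ _ _))
    (trans (+-cong (*-congˡ (outputProb-total A₁ f)) (*-congˡ (outputProb-total A₂ f)))
        (mix-const p 1#))
  outputProb-total (query x k) f = outputProb-total (k (f x)) f

  -- The expected value of w at the output, where however a run counts 1 as soon
  -- as two of its queries are separated by a coordinate in B.
  watch : (Bool → Carrier) →
          ∀ {d q} → Mask d → List (Cube d) → Algorithm d q → (Cube d → ℕ) → Carrier
  watch w B history (output b) f = w b
  watch w B history (toss p _ A₁ A₂) f =
    p * watch w B history A₁ f + (1# - p) * watch w B history A₂ f
  watch w B history (query x k) f =
    if alarm B history x then 1# else watch w B (x ∷ history) (k (f x)) f

  rejection : Bool → Carrier
  rejection b = if does (b Bool.≟ false) then 1# else 0#

  -- With this payoff and an empty history, `watch` is the probability that `B` separates two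
  -- queries.
  never : Bool → Carrier
  never _ = 0#

  module _ {w : Bool → Carrier} (w∈[0,1] : ∀ b → InUnitInterval (w b)) where

    watch-nonneg : ∀ {d q} (B : Mask d) history (A : Algorithm d q) f → 0# ≤ watch w B history A f
    watch-nonneg B history (output b) f = proj₁ (w∈[0,1] b)
    watch-nonneg B history (toss p p∈ A₁ A₂) f =
      ≤-respˡ-≈ (mix-const p 0#) (mix-mono p∈ (watch-nonneg B history A₁ f)
          (watch-nonneg B history A₂ f))
    watch-nonneg B history (query x k) f with alarm B history x
    ... | true = 0≤1
    ... | false = watch-nonneg B (x ∷ history) (k (f x)) f

    watch≤1 : ∀ {d q} (B : Mask d) history (A : Algorithm d q) f → watch w B history A f ≤ 1#
    watch≤1 B history (output b) f = proj₂ (w∈[0,1] b)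
    watch≤1 B history (toss p p∈ A₁ A₂) f =
      ≤-respʳ-≈ (mix-const p 1#) (mix-mono p∈ (watch≤1 B history A₁ f) (watch≤1 B history A₂ f))
    watch≤1 B history (query x k) f with alarm B history x
    ... | true = ≤-refl
    ... | false = watch≤1 B (x ∷ history) (k (f x)) f

  rejection∈[0,1] : ∀ b → InUnitInterval (rejection b)
  rejection∈[0,1] true = ≤-refl , 0≤1
  rejection∈[0,1] false = 0≤1 , ≤-refl

  outputProb≤1 : ∀ {d q} (A : Algorithm d q) f → outputProb A f false ≤ 1#
  outputProb≤1 (output b) f = proj₂ (rejection∈[0,1] b)
  outputProb≤1 (toss p p∈ A₁ A₂) f = ≤-respʳ-≈ (mix-const p 1#)
      (mix-mono p∈ (outputProb≤1 A₁ f) (outputProb≤1 A₂ f))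
  outputProb≤1 (query x k) f = outputProb≤1 (k (f x)) f

  outputProb-nonneg : ∀ {d q} (A : Algorithm d q) f → 0# ≤ outputProb A f false
  outputProb-nonneg (output b) f = proj₁ (rejection∈[0,1] b)
  outputProb-nonneg (toss p p∈ A₁ A₂) f = ≤-respˡ-≈ (mix-const p 0#)
      (mix-mono p∈ (outputProb-nonneg A₁ f) (outputProb-nonneg A₂ f))
  outputProb-nonneg (query x k) f = outputProb-nonneg (k (f x)) f

  reject≤watch : ∀ {d q} (B : Mask d) history (A : Algorithm d q) f →
                 outputProb A f false ≤ watch rejection B history A f
  reject≤watch B history (output b) f = ≤-refl
  reject≤watch B history (toss p p∈ A₁ A₂) f = mix-mono p∈ (reject≤watch B history A₁ f)
      (reject≤watch B history A₂ f)
  reject≤watch B history (query x k) f with alarm B history x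
  ... | true = outputProb≤1 (k (f x)) f
  ... | false = reject≤watch B (x ∷ history) (k (f x)) f

  -- A union bound: a run counted on the left is either stopped or goes on to reject.
  watch≤reject+capture : ∀ {d q} (B : Mask d) history (A : Algorithm d q) f →
                 watch rejection B history A f ≤ outputProb A f false + watch never B history A f
  watch≤reject+capture B history (output b) f = reflexive
      (solve 1 (λ x → x := x :+ :0) refl (rejection b))
  watch≤reject+capture B history (toss p p∈ A₁ A₂) f = ≤-trans
    (mix-mono p∈ (watch≤reject+capture B history A₁ f) (watch≤reject+capture B history A₂ f))
    (reflexive (mix-+ p _ _ _ _))
  watch≤reject+capture B history (query x k) f with alarm B history x
  ... | true = ≤-from-gap (outputProb-nonneg (k (f x)) f)
      (solve 1 (λ a → a :+ :1 := :1 :+ a) refl _)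
  ... | false = watch≤reject+capture B (x ∷ history) (k (f x)) f

  -- An unstopped run reads only values at points that raise no alarm, and a longer history raises
  -- more alarms, so the hypothesis survives each query.
  watch-local : ∀ w {d q} (B : Mask d) history (A : Algorithm d q) {f g} →
                (∀ y → alarm B history y ≡ false → f y ≡ g y) →
                watch w B history A f ≡ watch w B history A g
  watch-local w B history (output b) f≗g = ≡.refl
  watch-local w B history (toss p _ A₁ A₂) f≗g =
    ≡.cong₂ (λ a b → p * a + (1# - p) * b) (watch-local w B history A₁ f≗g)
        (watch-local w B history A₂ f≗g)
  watch-local w B history (query x k) {f} {g} f≗g with alarm B history x in eq
  ... | true = ≡.refl
  ... | false rewrite f≗g x eq = watch-local w B (x ∷ history) (k (g x))
    λ y quiet → f≗g y (Bool.∨-conicalʳ (captures B x y) _ quiet)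

  -- The mixed second difference over every square vanishes: `G` is a function of the left choice
  -- plus a function of the right choice.
  Modular : ∀ {d} → Mask d → ((Cube d → ℕ) → Carrier) → Set _
  Modular B G = ∀ {f} → Square B f →
    G (f false false) + G (f true true) ≈ G (f false true) + G (f true false)

  -- Before the first query below the node of the square the four runs agree;
  -- afterwards they see only one side of it.
  watch-modular : ∀ w {d q} (B : Mask d) history (A : Algorithm d q) →
                  Modular B (watch w B history A)
  watch-modular w B history (output b) S = refl
  watch-modular w B history (toss p _ A₁ A₂) S = trans (sym (mix-+ p _ _ _ _))
    (trans (+-cong (*-congˡ (watch-modular w B history A₁ S))
        (*-congˡ (watch-modular w B history A₂ S)))
      (mix-+ p _ _ _ _))
  watch-modular w B history (query x k) {f} S with alarm B history x
  ... | true = refl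
  ... | false with onLeft S x in l | onRight S x in r
  ... | false | false
    rewrite ≡.sym (off-right S x r {false} {false} {true})
          | ≡.sym (off-left S x l {false} {true} {false})
          | ≡.trans (≡.sym (off-left S x l {false} {true} {true}))
              (≡.sym (off-right S x r {false} {false} {true}))
    = watch-modular w B (x ∷ history) (k (f false false x)) S
  -- A query on the left turns every later one on the right into an alarm, so the right choice no
  -- longer affects the run and the terms match in pairs.
  ... | true | _ = +-cong (≡⇒≈ (after-left false)) (≡⇒≈ (≡.sym (after-left true)))
    where
    after-left : ∀ i → watch w B (x ∷ history) (k (f i false x)) (f i false)
                     ≡ watch w B (x ∷ history) (k (f i true x)) (f i true)
    after-left i rewrite off-right S x (not-both-sides S x l) {i} {false} {true} =
      watch-local w B (x ∷ history) (k (f i true x)) λ y quiet →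
        off-right S y (not-right y (Bool.∨-conicalˡ _ _ quiet))
      where
      not-right : ∀ y → captures B x y ≡ false → onRight S y ≡ false
      not-right y c with onRight S y in r
      ... | false = ≡.refl
      ... | true with () ← ≡.trans (≡.sym c) (sides-captured S x y l r)
  ... | false | true = trans (+-cong (≡⇒≈ (after-right false)) (≡⇒≈ (≡.sym (after-right true))))
                             (solve 2 (λ a b → a :+ b := b :+ a) refl _ _)
    where
    after-right : ∀ j → watch w B (x ∷ history) (k (f false j x)) (f false j)
                      ≡ watch w B (x ∷ history) (k (f true j x)) (f true j)
    after-right j rewrite off-left S x l {false} {true} {j} =
      watch-local w B (x ∷ history) (k (f true j x)) λ y quiet →
        off-left S y (not-left y (Bool.∨-conicalˡ _ _ quiet))
      where
      not-left : ∀ y → captures B x y ≡ false → onLeft S y ≡ false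
      not-left y c with onLeft S y in l′
      ... | false = ≡.refl
      ... | true with () ← ≡.trans (≡.sym c)
          (≡.trans (captures-sym B x y) (sides-captured S y x l′ r))

  -- Counting separations over disjoint blocks

  ∑-zero : ∀ {a} {A : Set a} (xs : List A) → ∑ xs (λ _ → 0#) ≈ 0#
  ∑-zero [] = refl
  ∑-zero (x ∷ xs) = trans (+-congˡ (∑-zero xs)) (solve 0 (:0 :+ :0 := :0) refl)

  ∑-mix : ∀ {a} {A : Set a} p (xs : List A) g h →
          ∑ xs (λ x → p * g x + (1# - p) * h x) ≈ p * ∑ xs g + (1# - p) * ∑ xs h
  ∑-mix p [] g h = sym (mix-const p 0#)
  ∑-mix p (x ∷ xs) g h = trans (+-congˡ (∑-mix p xs g h))
    (sym (mix-+ p _ _ _ _))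

  module _ {a} {A : Set a} (t : A → Bool) (g : A → Carrier) where
    private
      untriggered = filter (λ x → t x Bool.≟ false)

      ∑-none : ∀ xs → All (λ x → t x ≡ false) xs →
               ∑ xs (λ x → if t x then 1# else g x) ≡ ∑ (untriggered xs) g
      ∑-none [] [] = ≡.refl
      ∑-none (x ∷ xs) (eq ∷ eqs) rewrite eq = ≡.cong (g x +_) (∑-none xs eqs)

    ∑-at-most-one : ∀ xs → AllPairs (λ x y → t x ≡ true → t y ≡ true → ⊥) xs →
                    ∑ xs (λ x → if t x then 1# else g x) ≤ 1# + ∑ (untriggered xs) g
    ∑-at-most-one [] [] = ≤-from-gap 0≤1 (solve 0 (:1 :+ :0 := :0 :+ :1) refl)
    ∑-at-most-one (x ∷ xs) (alone ∷ pairs) with t x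
    ... | true = reflexive
        (+-congˡ (≡⇒≈ (∑-none xs (All.map (λ ¬t → Bool.¬-not (¬t ≡.refl)) alone))))
    ... | false = ≤-trans (+-mono-≤ ≤-refl (∑-at-most-one xs pairs))
      (reflexive (solve 2 (λ a b → a :+ (:1 :+ b) := :1 :+ (a :+ b)) refl _ _))

  -- Each query costs at most 1: by `one-alarm` it triggers at most one of the quiet blocks, and
  -- triggered blocks leave the list.
  capture-count : ∀ {d q} (A : Algorithm d q) f history (Bs : List (Mask d)) →
                  AllPairs Disjoint Bs → All (λ B → Quiet B history) Bs →
                  ∑ Bs (λ B → watch never B history A f) ≤ fromℕ q
  capture-count {q = q} (output _) f history Bs disjoint quiet = ≤-respˡ-≈ (sym (∑-zero Bs))
      (0≤fromℕ q)
  capture-count {q = q} (toss p p∈ A₁ A₂) f history Bs disjoint quiet =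
    ≤-respˡ-≈ (sym (∑-mix p Bs _ _)) (≤-respʳ-≈ (mix-const p (fromℕ q))
      (mix-mono p∈ (capture-count A₁ f history Bs disjoint quiet)
          (capture-count A₂ f history Bs disjoint quiet)))
  capture-count (query x k) f history Bs disjoint quiet =
    ≤-trans (∑-at-most-one (λ B → alarm B history x) _ Bs (one-alarms disjoint quiet))
      (+-mono-≤ ≤-refl (capture-count (k (f x)) f (x ∷ history) _
        (AllPairs.filter⁺ _ disjoint)
        (All.zipWith (λ { {B} (quiet , silent) → quiet-∷ B x quiet silent })
          (All.filter⁺ (λ B → alarm B history x Bool.≟ false) quiet ,
           All.all-filter (λ B → alarm B history x Bool.≟ false) Bs))))
    where
    one-alarms : ∀ {Bs} → AllPairs Disjoint Bs → All (λ B → Quiet B history) Bs →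
      AllPairs (λ B B′ → alarm B history x ≡ true → alarm B′ history x ≡ true → ⊥) Bs
    one-alarms [] [] = []
    one-alarms (D ∷ Ds) (quiet ∷ quiets) =
      All.zipWith (λ { (disjoint , quiet′) → one-alarm history x disjoint quiet quiet′ })
          (D , quiets)
      ∷ one-alarms Ds quiets

  -- Averaging over the labels

  module Averaging (k : ℕ) where
    K : ℕ
    K = suc k

    u : Carrier
    u = reciprocal k

    average : (Fin K → Carrier) → Carrier
    average g = u * sum g

    average-mono : ∀ {g h} → (∀ a → g a ≤ h a) → average g ≤ average h
    average-mono g≤h = *-monoˡ-≤ (0≤reciprocal k) (sum-mono g≤h)

    average-+ : ∀ g h → average (λ a → g a + h a) ≈ average g + average h
    average-+ g h = trans (*-congˡ (sum-+ g h))
        (solve 3 (λ u a b → u :* (a :+ b) := u :* a :+ u :* b) refl u _ _)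

    average-const : ∀ x → average (λ _ → x) ≈ x
    average-const x = trans (*-congˡ (sum-const K x))
      (trans (solve 3 (λ u n x → u :* (n :* x) := (n :* u) :* x) refl u (fromℕ K) x)
        (trans (*-congʳ (reciprocal-inverse k)) (solve 1 (λ x → :1 :* x := x) refl x)))

    𝔼 : ∀ {d} → (Seed K d → Carrier) → Carrier
    𝔼 {zero} g = g leaf
    𝔼 {suc d} g = average λ a → 𝔼 λ s₀ → 𝔼 λ s₁ → g (node a s₀ s₁)

    𝔼-mono : ∀ {d} {g h : Seed K d → Carrier} → (∀ s → g s ≤ h s) → 𝔼 g ≤ 𝔼 h
    𝔼-mono {zero} g≤h = g≤h leaf
    𝔼-mono {suc d} g≤h = average-mono λ a → 𝔼-mono λ s₀ → 𝔼-mono λ s₁ → g≤h (node a s₀ s₁)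

    𝔼-cong : ∀ {d} {g h : Seed K d → Carrier} → (∀ s → g s ≈ h s) → 𝔼 g ≈ 𝔼 h
    𝔼-cong g≈h = antisym (𝔼-mono (reflexive ∘ g≈h)) (𝔼-mono (reflexive ∘ sym ∘ g≈h))

    average-cong : ∀ {g h} → (∀ a → g a ≈ h a) → average g ≈ average h
    average-cong g≈h = antisym (average-mono (reflexive ∘ g≈h))
        (average-mono (reflexive ∘ sym ∘ g≈h))

    𝔼-+ : ∀ {d} (g h : Seed K d → Carrier) → 𝔼 (λ s → g s + h s) ≈ 𝔼 g + 𝔼 h
    𝔼-+ {zero} g h = refl
    𝔼-+ {suc d} g h = trans
      (average-cong λ a → trans (𝔼-cong λ s₀ → 𝔼-+ (λ s₁ → g (node a s₀ s₁))
          (λ s₁ → h (node a s₀ s₁))) (𝔼-+ {d} _ _))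
      (average-+ (λ a → 𝔼 λ s₀ → 𝔼 λ s₁ → g (node a s₀ s₁))
          (λ a → 𝔼 λ s₀ → 𝔼 λ s₁ → h (node a s₀ s₁)))

    𝔼-const : ∀ {d} x → 𝔼 {d} (λ _ → x) ≈ x
    𝔼-const {zero} x = refl
    𝔼-const {suc d} x = trans (average-cong λ _ → trans (𝔼-cong {d} λ _ → 𝔼-const {d} x)
        (𝔼-const {d} x)) (average-const x)

    𝔼-bound : ∀ {d} {g h : Seed K d → Carrier} x → (∀ s → g s ≤ h s + x) → 𝔼 g ≤ 𝔼 h + x
    𝔼-bound {d} x g≤h+x = ≤-trans (𝔼-mono g≤h+x)
        (reflexive (trans (𝔼-+ {d} _ _) (+-congˡ (𝔼-const {d} x))))

    average-bound : ∀ {g h} x → (∀ a → g a ≤ h a + x) → average g ≤ average h + x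
    average-bound {g} {h} x g≤h+x = ≤-trans (average-mono g≤h+x)
        (reflexive (trans (average-+ h (λ _ → x)) (+-congˡ (average-const x))))

    𝔼-balance : ∀ {d} {g₁ g₂ g₃ g₄ : Seed K d → Carrier} → (∀ s → g₁ s + g₂ s ≈ g₃ s + g₄ s) →
        𝔼 g₁ + 𝔼 g₂ ≈ 𝔼 g₃ + 𝔼 g₄
    𝔼-balance {d} eq = trans (sym (𝔼-+ {d} _ _)) (trans (𝔼-cong eq) (𝔼-+ {d} _ _))

    𝔼-∑ : ∀ {d a} {A : Set a} (xs : List A) (g : A → Seed K d → Carrier) →
          ∑ xs (λ x → 𝔼 (g x)) ≈ 𝔼 (λ s → ∑ xs (λ x → g x s))
    𝔼-∑ {d} [] g = sym (𝔼-const {d} 0#)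
    𝔼-∑ {d} (x ∷ xs) g = trans (+-congˡ (𝔼-∑ xs g)) (sym (𝔼-+ {d} _ _))

    -- A modular H is a sum of a function of i and a function of j.
    telescope : ∀ n (H : ℕ → ℕ → Carrier) → (∀ i i′ j j′ → H i j + H i′ j′ ≈ H i j′ + H i′ j) →
                sum {n} (λ a → H (suc (toℕ a)) (toℕ a)) + H 0 n
                  ≈ sum {n} (λ a → H (toℕ a) (suc (toℕ a))) + H n 0
    telescope zero H modular = refl
    telescope (suc n) H modular =
      -- The shifted sums have the boundary terms `H 1 (suc n)` and `H (suc n) 1`; `m₁` and `m₂`
      -- trade them, via `H 1 1`, for the required boundary terms and the first summands.
      let ih = telescope n (λ i j → H (suc i) (suc j))
                 (λ i i′ j j′ → modular (suc i) (suc i′) (suc j) (suc j′))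
          m₁ = modular (suc n) 1 1 0
          m₂ = modular 1 0 1 (suc n)
      in combine ih m₁ m₂
      where
      combine : ∀ {a s b s′ c e f g h} → s + b ≈ s′ + c → c + a ≈ e + f → f + h ≈ b + g →
          (a + s) + h ≈ (g + s′) + e
      combine {a} {s} {b} {s′} {c} {e} {f} {g} {h} p q r = trans
        (solve 9 (λ a s b s′ c e f g h → (a :+ s) :+ h := (s :+ b) :+ (c :+ a) :+ (f :+ h) :-
            (b :+ c :+ f)) refl a s b s′ c e f g h)
        (trans (+-congʳ (+-cong (+-cong p q) r))
          (solve 9 (λ a s b s′ c e f g h → (s′ :+ c) :+ (e :+ f) :+ (b :+ g) :- (b :+ c :+ f)
              := (g :+ s′) :+ e) refl a s b s′ c e f g h))

    -- One `u` for each of the 2^d - 1 inner nodes of the tree.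
    cost : ℕ → Carrier
    cost zero = 0#
    cost (suc d) = u + (cost d + cost d)

    cost+u : ∀ d → cost d + u ≈ fromℕ (2 ℕ.^ d) * u
    cost+u zero = solve 1 (λ u → :0 :+ u := (:1 :+ :0) :* u) refl u
    cost+u (suc d) = trans
      (solve 2 (λ u c → u :+ (c :+ c) :+ u := (c :+ u) :+ (c :+ u)) refl u (cost d))
      (trans (+-cong (cost+u d) (cost+u d))
        (trans (solve 2 (λ n u → n :* u :+ n :* u := (:ℕ 2 :* n) :* u) refl (fromℕ (2 ℕ.^ d)) u)
          (*-congʳ (sym (×1-homo-* 2 (2 ℕ.^ d))))))

    -- The boundary terms in `telescope` lie in the unit interval, so the first sum exceeds the
    -- second by at most 1, and `u` is 1/K.
    swap-digit : ∀ (H : ℕ → ℕ → Carrier) → (∀ i i′ j j′ → H i j + H i′ j′ ≈ H i j′ + H i′ j) →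
                 (∀ i j → InUnitInterval (H i j)) →
                 average (λ a → H (digit a true) (digit a false))
                   ≤ average (λ a → H (digit a false) (digit a true)) + u
    swap-digit H modular bounds = ≤-trans (*-monoˡ-≤ (0≤reciprocal k) bound)
        (reflexive (solve 2 (λ u s → u :* (s :+ :1) := u :* s :+ u) refl u _))
      where
      bound : sum {K} (λ a → H (suc (toℕ a)) (toℕ a)) ≤ sum {K} (λ a → H (toℕ a) (suc (toℕ a))) + 1#
      bound = ≤-trans (≤-from-gap (proj₁ (bounds 0 K)) refl)
        (≤-trans (reflexive (telescope K H modular)) (+-mono-≤ ≤-refl (proj₂ (bounds K 0))))

    -- Nodes are unflipped from the leaves up, each at a cost of at most `u`; fixing or averaging
    -- over one subtree leaves `G` modular in the other.
    flip-none : ∀ {d} acc (B : Mask d) G → (∀ f → InUnitInterval (G f)) → Modular B G →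
                𝔼 (λ s → G (hard acc s B)) ≤ 𝔼 (λ s → G (hard acc s none)) + cost d
    flip-none acc [] G bounds modular = reflexive (solve 1 (λ x → x := x :+ :0) refl _)
    flip-none {suc d} acc (b ∷ B) G bounds modular =
      ≤-trans (average-bound (cost d + cost d) below)
        (≤-trans (+-mono-≤ (unflip-root b modular) ≤-refl)
          (reflexive (solve 3 (λ x u c → x :+ u :+ c := x :+ (u :+ c)) refl _ _ _)))
      where
      H : ℕ → ℕ → Carrier
      H i j = 𝔼 λ s₀ → 𝔼 λ s₁ →
          G (join (hard (acc ℕ.* suc K ℕ.+ i) s₀ none) (hard (acc ℕ.* suc K ℕ.+ j) s₁ none))

      𝔼-unit : ∀ {d} {g : Seed K d → Carrier} → (∀ s → InUnitInterval (g s)) → InUnitInterval (𝔼 g)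
      𝔼-unit {d} bounds = ≤-respˡ-≈ (𝔼-const {d} 0#) (𝔼-mono (proj₁ ∘ bounds)) ,
                          ≤-respʳ-≈ (𝔼-const {d} 1#) (𝔼-mono (proj₂ ∘ bounds))

      below : ∀ a → 𝔼 (λ s₀ → 𝔼 λ s₁ → G (hard acc (node a s₀ s₁) (b ∷ B)))
                      ≤ H (digit a b) (digit a (not b)) + (cost d + cost d)
      below a = ≤-trans
        (𝔼-bound (cost d) λ s₀ → flip-none _ B (λ f → G (join (hard _ s₀ B) f)) (λ f → bounds _)
            (λ S → modular (right S _)))
        (≤-trans
          (+-mono-≤ (flip-none _ B (λ f → 𝔼 λ s₁ → G (join f (hard _ s₁ none)))
            (λ f → 𝔼-unit {d} λ s₁ → bounds _) (λ S → 𝔼-balance {d} λ s₁ → modular (left S _)))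
            ≤-refl)
          (reflexive (solve 2 (λ x c → x :+ c :+ c := x :+ (c :+ c)) refl _ (cost d))))

      unflip-root : ∀ b → Modular (b ∷ B) G →
                    average (λ a → H (digit a b) (digit a (not b)))
                      ≤ average (λ a → H (digit a false) (digit a true)) + u
      unflip-root false _ = ≤-from-gap (0≤reciprocal k) refl
      -- `root` allows arbitrary functions on the two halves, so for fixed seeds `G` is modular in
      -- the two digits at the node.
      unflip-root true modular = swap-digit H
        (λ i i′ j j′ → 𝔼-balance {d} λ s₀ → 𝔼-balance {d} λ s₁ → modular
          (root (λ t → if t then hard (acc ℕ.* suc K ℕ.+ i′) s₀ none
                            else hard (acc ℕ.* suc K ℕ.+ i) s₀ none)
                (λ t → if t then hard (acc ℕ.* suc K ℕ.+ j′) s₁ none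
                            else hard (acc ℕ.* suc K ℕ.+ j) s₁ none)))
        (λ i j → 𝔼-unit {d} λ s₀ → 𝔼-unit {d} λ s₁ → bounds _)

  -- Distance to monotonicity

  indicator : Bool → Carrier
  indicator b = if b then 1# else 0#

  Prob-[] : ∀ μ P → Prob {0} μ P ≈ indicator (P [])
  Prob-[] μ P with P []
  ... | true = solve 0 (:1 :+ :0 := :1) refl
  ... | false = solve 0 (:0 :+ :0 := :0) refl

  private
    total-++ : ∀ xs ys → foldr _+_ 0# (xs ++ ys) ≈ foldr _+_ 0# xs + foldr _+_ 0# ys
    total-++ [] ys = solve 1 (λ y → y := :0 :+ y) refl _
    total-++ (x ∷ xs) ys = trans (+-congˡ (total-++ xs ys))
        (solve 3 (λ x y z → x :+ (y :+ z) := x :+ y :+ z) refl x _ _)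

    total-scale : ∀ {a b} {A : Set a} {A′ : Set b} w
                  (e : A → A′) (P : A′ → Bool) (m : A → Carrier) xs →
      foldr _+_ 0# (map (λ x → if P (e x) then w * m x else 0#) xs)
        ≈ w * foldr _+_ 0# (map (λ x → if P (e x) then m x else 0#) xs)
    total-scale w e P m [] = solve 1 (λ w → :0 := w :* :0) refl w
    total-scale w e P m (x ∷ xs) with P (e x)
    ... | true = trans (+-congˡ (total-scale w e P m xs))
        (solve 3 (λ w x y → w :* x :+ w :* y := w :* (x :+ y)) refl w _ _)
    ... | false = trans (+-congˡ (total-scale w e P m xs))
        (solve 2 (λ w y → :0 :+ w :* y := w :* (:0 :+ y)) refl w _)

  Prob-∷ : ∀ {d} (μ : Fin (suc d) → Carrier) P →
           Prob μ P ≈ μ Fin.zero * Prob (μ ∘ Fin.suc) (P ∘ (false ∷_))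
                      + (1# - μ Fin.zero) * Prob (μ ∘ Fin.suc) (P ∘ (true ∷_))
  Prob-∷ {d} μ P = trans
    (≡⇒≈ (≡.cong (foldr _+_ 0#) (List.map-++ weight (map (false ∷_) (points d)) _)))
    (trans (total-++ (map weight (map (false ∷_) (points d))) _) (+-cong (half false) (half true)))
    where
    weight : Cube (suc d) → Carrier
    weight x = if P x then mass μ x else 0#
    half : ∀ b → foldr _+_ 0# (map weight (map (b ∷_) (points d)))
               ≈ (if b then 1# - μ Fin.zero else μ Fin.zero) * Prob (μ ∘ Fin.suc) (P ∘ (b ∷_))
    half b = trans (≡⇒≈ (≡.cong (foldr _+_ 0#) (≡.sym (List.map-∘ {g = weight} (points d)))))
      (total-scale _ (b ∷_) P (mass (μ ∘ Fin.suc)) (points d))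

  likelihood : Bool → Carrier → Carrier
  likelihood v p = if v then 1# - p else p

  likelihood-unit : ∀ v {p} → InUnitInterval p → InUnitInterval (likelihood v p)
  likelihood-unit false p∈ = p∈
  likelihood-unit true {p} (0≤p , p≤1) = gap p≤1 , ≤-from-gap 0≤p
      (solve 1 (λ p → :1 := :1 :- p :+ p) refl p)

  Prob-∷′ : ∀ v {d} (μ : Fin (suc d) → Carrier) P → let w = likelihood v (μ Fin.zero) in
            Prob μ P ≈ w * Prob (μ ∘ Fin.suc) (P ∘ (v ∷_))
                       + (1# - w) * Prob (μ ∘ Fin.suc) (P ∘ (not v ∷_))
  Prob-∷′ false μ P = Prob-∷ μ P
  Prob-∷′ true μ P = trans (Prob-∷ μ P)
    (solve 3 (λ p a b → p :* a :+ (:1 :- p) :* b := (:1 :- p) :* b :+ (:1 :- (:1 :- p)) :* a) refl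
        (μ Fin.zero) _ _)

  -- Conditioning on every coordinate in B being v, which makes sense even if that
  -- event has probability 0.
  conditional : Bool → ∀ {d} → Mask d → (Fin d → Carrier) → (Cube d → Bool) → Carrier
  conditional v [] μ P = indicator (P [])
  conditional v (true ∷ B) μ P = conditional v B (μ ∘ Fin.suc) (P ∘ (v ∷_))
  conditional v (false ∷ B) μ P =
    μ Fin.zero * conditional v B (μ ∘ Fin.suc) (P ∘ (false ∷_))
      + (1# - μ Fin.zero) * conditional v B (μ ∘ Fin.suc) (P ∘ (true ∷_))

  blockMass : Bool → ∀ {d} → Mask d → (Fin d → Carrier) → Carrier
  blockMass v [] μ = 1#
  blockMass v (true ∷ B) μ = likelihood v (μ Fin.zero) * blockMass v B (μ ∘ Fin.suc)
  blockMass v (false ∷ B) μ = blockMass v B (μ ∘ Fin.suc)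

  conditional-unit : ∀ v {d} (B : Mask d) {μ} P → (∀ r → InUnitInterval (μ r)) →
                     InUnitInterval (conditional v B μ P)
  conditional-unit v [] P μ∈ with P []
  ... | true = 0≤1 , ≤-refl
  ... | false = ≤-refl , 0≤1
  conditional-unit v (true ∷ B) P μ∈ = conditional-unit v B _ (μ∈ ∘ Fin.suc)
  conditional-unit v (false ∷ B) P μ∈ =
    let 0≤a , a≤1 = conditional-unit v B (P ∘ (false ∷_)) (μ∈ ∘ Fin.suc)
        0≤b , b≤1 = conditional-unit v B (P ∘ (true ∷_)) (μ∈ ∘ Fin.suc)
    in ≤-respˡ-≈ (mix-const _ 0#) (mix-mono (μ∈ Fin.zero) 0≤a 0≤b)
     , ≤-respʳ-≈ (mix-const _ 1#) (mix-mono (μ∈ Fin.zero) a≤1 b≤1)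

  -- For each choice of the coordinates outside `B`, either the all-`v` point satisfies `P` or `Q`
  -- holds on the whole fibre; each case contributes 1.
  conditional+Prob : ∀ v {d} (B : Mask d) {μ} P Q → (∀ r → InUnitInterval (μ r)) →
    (∀ {x y} → Fibre v B x y → P x ∨ Q y ≡ true) → 1# ≤ conditional v B μ P + Prob μ Q
  conditional+Prob v [] {μ} P Q μ∈ cover = ≤-respʳ-≈ (+-congˡ (sym (Prob-[] μ Q))) (case (cover []))
    where
    case : ∀ {a b} → a ∨ b ≡ true → 1# ≤ indicator a + indicator b
    case {false} {true} eq = reflexive (solve 0 (:1 := :0 :+ :1) refl)
    case {true} {false} eq = reflexive (solve 0 (:1 := :1 :+ :0) refl)
    case {true} {true} eq = ≤-from-gap 0≤1 refl
  conditional+Prob v (false ∷ B) {μ} P Q μ∈ cover =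
    ≤-trans (≤-respˡ-≈ (mix-const (μ Fin.zero) 1#)
              (mix-mono (μ∈ Fin.zero)
                (conditional+Prob v B (P ∘ (false ∷_)) (Q ∘ (false ∷_)) (μ∈ ∘ Fin.suc)
                  (cover ∘ outside false))
                (conditional+Prob v B (P ∘ (true ∷_)) (Q ∘ (true ∷_)) (μ∈ ∘ Fin.suc)
                  (cover ∘ outside true))))
      (reflexive (trans
        (mix-+ (μ Fin.zero) _ _ _ _)
        (+-congˡ (sym (Prob-∷ μ Q)))))
  conditional+Prob v (true ∷ B) {μ} P Q μ∈ cover =
    ≤-trans (≤-respˡ-≈ (mix-const (μ Fin.zero) 1#)
              (mix-mono (μ∈ Fin.zero)
                (conditional+Prob v B (P ∘ (v ∷_)) (Q ∘ (false ∷_)) (μ∈ ∘ Fin.suc)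
                  (cover ∘ inside false))
                (conditional+Prob v B (P ∘ (v ∷_)) (Q ∘ (true ∷_)) (μ∈ ∘ Fin.suc)
                  (cover ∘ inside true))))
      (reflexive (trans
        (solve 4 (λ p a b d → p :* (a :+ b) :+ (:1 :- p) :* (a :+ d) := a
            :+ (p :* b :+ (:1 :- p) :* d)) refl (μ Fin.zero) _ _ _)
        (+-congˡ (sym (Prob-∷ μ Q)))))

  -- The probability of a set that is the all-`v` point, of mass `m`, in a fraction `t` of the
  -- fibres and everything else in the other fibres.
  fibrewise : Carrier → Carrier → Carrier
  fibrewise m t = m * t + (1# - m) * (1# - t)

  -- In each fibre P contains the point that is v on B, or else all the others.
  fibrewise≤Prob : ∀ v {d} (B : Mask d) {μ} P → (∀ r → InUnitInterval (μ r)) →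
    (∀ {x y} → Fibre v B x y → x ≡ y ⊎ P x ∨ P y ≡ true) →
    fibrewise (blockMass v B μ) (conditional v B μ P) ≤ Prob μ P
  fibrewise≤Prob v [] {μ} P μ∈ cover =
    reflexive (trans (solve 1 (λ t → :1 :* t :+ (:1 :- :1) :* (:1 :- t) := t) refl _)
        (sym (Prob-[] μ P)))
  fibrewise≤Prob v (false ∷ B) {μ} P μ∈ cover =
    ≤-trans (reflexive (solve 4 (λ p m s t →
               m :* (p :* s :+ (:1 :- p) :* t) :+ (:1 :- m) :* (:1 :- (p :* s :+ (:1 :- p) :* t))
               := p :* (m :* s :+ (:1 :- m) :* (:1 :- s)) :+ (:1 :- p) :*
                   (m :* t :+ (:1 :- m) :* (:1 :- t)))
               refl (μ Fin.zero) (blockMass v B (μ ∘ Fin.suc)) _ _))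
      (≤-trans (mix-mono (μ∈ Fin.zero)
                 (fibrewise≤Prob v B (P ∘ (false ∷_)) (μ∈ ∘ Fin.suc)
                   (Sum.map₁ ∷-injectiveʳ ∘ cover ∘ outside false))
                 (fibrewise≤Prob v B (P ∘ (true ∷_)) (μ∈ ∘ Fin.suc)
                   (Sum.map₁ ∷-injectiveʳ ∘ cover ∘ outside true)))
        (reflexive (sym (Prob-∷ μ P))))
  fibrewise≤Prob v (true ∷ B) {μ} P μ∈ cover =
    ≤-trans (reflexive (solve 3 (λ w m t →
               w :* m :* t :+ (:1 :- w :* m) :* (:1 :- t)
               := w :* (m :* t :+ (:1 :- m) :* (:1 :- t)) :+ (:1 :- w) :* (:1 :- t))
               refl (likelihood v (μ Fin.zero)) (blockMass v B (μ ∘ Fin.suc)) _))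
      (≤-trans (mix-mono (likelihood-unit v (μ∈ Fin.zero))
                 (fibrewise≤Prob v B (P ∘ (v ∷_)) (μ∈ ∘ Fin.suc)
                     (Sum.map₁ ∷-injectiveʳ ∘ cover ∘ inside v))
                 -- When this coordinate is not `v`, no point equals the all-`v` one, so wherever
                 -- that point misses `P` the rest of the slice lies in `P`.
                 (≤-from-gap
                   (gap (conditional+Prob v B (P ∘ (v ∷_)) (P ∘ (not v ∷_)) (μ∈ ∘ Fin.suc)
                     (distinct ∘ cover ∘ inside (not v))))
                   (solve 2 (λ t q → q := :1 :- t :+ (t :+ q :- :1)) refl _ _)))
        (reflexive (sym (Prob-∷′ v μ P))))
    where
    distinct : ∀ {A : Set} {d} {x y : Cube d} → (v ∷ x) ≡ (not v ∷ y) ⊎ A → A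
    distinct (inj₁ eq) = ⊥-elim (Bool.not-¬ ≡.refl (∷-injectiveˡ eq))
    distinct (inj₂ a) = a

  record Balanced (v : Bool) {d} (μ : Fin d → Carrier) (B : Mask d) : Set ℓ₂ where
    field
      mass≥¼ : 1# ≤ fromℕ 4 * blockMass v B μ
      mass≤½ : fromℕ 2 * blockMass v B μ ≤ 1#

  -- Affine in `t` with end values `1 - m` and `m`, both at least 1/4.
  fibrewise≥¼ : ∀ {m t} → 1# ≤ fromℕ 4 * m → fromℕ 2 * m ≤ 1# → InUnitInterval t →
      1# ≤ fromℕ 4 * fibrewise m t
  fibrewise≥¼ {m} {t} m≥¼ m≤½ (0≤t , t≤1) = ≤-from-gap
      (0≤t *⁺ gap m≥¼ +⁺ gap t≤1 *⁺ (gap m≤½ +⁺ gap m≤½ +⁺ 0≤1))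
    (solve 2 (λ m t → :ℕ 4 :* (m :* t :+ (:1 :- m) :* (:1 :- t))
      := :1 :+ (t :* (:ℕ 4 :* m :- :1) :+ (:1 :- t) :* ((:1 :- :ℕ 2 :* m) :+ (:1 :- :ℕ 2 :* m)
          :+ :1))) refl m t)

  -- A monotone `g` cannot agree with the function at both ends of an inverted pair, so the
  -- disagreement set meets every such pair and has probability at least 1/4, above 1/10.
  hard-far : ∀ v {d K} {μ : Fin d → Carrier} {B ε} (s : Seed K d) → (∀ r → InUnitInterval (μ r)) →
             Balanced v μ B → fromℕ 10 * ε ≤ 1# → FarFromMonotone μ ε (hard 0 s B)
  hard-far v {μ = μ} {B} {ε} s μ∈ balanced ε≤⅒ g g-mono = ≰⇒< λ D≤ε →
      1≰0 (contradictory D≥¼ D≤ε ε≤⅒)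
    where
    open Balanced balanced
    f = hard 0 s B
    P = λ x → not (does (f x ℕ.≟ g x))
    D = disagreement μ f g

    agree : ∀ x → P x ≡ false → f x ≡ g x
    agree x eq = ℕ.≡ᵇ⇒≡ (f x) (g x) (≡.subst T (≡.sym (Bool.not-injective eq)) tt)

    order : ∀ v {x y} → Fibre v B x y → P x ≡ false → P y ≡ false →
            f (lower v x y) ℕ.≤ f (upper v x y)
    order false {x} {y} p px py rewrite agree x px | agree y py = g-mono (fibre-ordered false p)
    order true {x} {y} p px py rewrite agree x px | agree y py = g-mono (fibre-ordered true p)

    cover : ∀ {x y} → Fibre v B x y → x ≡ y ⊎ P x ∨ P y ≡ true
    cover {x} {y} p with fibre-inverted v 0 s p
    ... | inj₁ x≡y = inj₁ x≡y
    ... | inj₂ inv with P x in px | P y in py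
    ... | true | _ = inj₂ ≡.refl
    ... | false | true = inj₂ ≡.refl
    ... | false | false = ⊥-elim (ℕ.<⇒≱ inv (order v p px py))

    D≥¼ : 1# ≤ fromℕ 4 * D
    D≥¼ = ≤-trans (fibrewise≥¼ mass≥¼ mass≤½ (conditional-unit v B P μ∈))
      (*-monoˡ-≤ (0≤fromℕ 4) (fibrewise≤Prob v B P μ∈ cover))

    contradictory : ∀ {D ε} → 1# ≤ fromℕ 4 * D → D ≤ ε → fromℕ 10 * ε ≤ 1# → 1# ≤ 0#
    -- 5(4D - 1) + 20(ε - D) + 2(1 - 10ε) = -3, although each summand is nonnegative.
    contradictory {D} {ε} p q r = *-cancelˡ-≤ 2
        (≤-from-gap (0≤fromℕ 5 *⁺ gap p +⁺ 0≤fromℕ 20 *⁺ gap q +⁺ 0≤fromℕ 2 *⁺ gap r)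
      (solve 2 (λ D ε → :ℕ 3 :* :0 := :ℕ 3 :* :1 :+ (:ℕ 5 :* (:ℕ 4 :* D :- :1) :+ :ℕ 20 :* (ε :- D)
          :+ :ℕ 2 :* (:1 :- :ℕ 10 :* ε))) refl D ε))

  -- Packing blocks

  -- Both values of `v` consult the same comparison, so exactly one of them is likely, even in a
  -- tie.
  likely : Carrier → Bool → Bool
  likely p v with total p (1# - p)
  ... | inj₁ _ = v
  ... | inj₂ _ = not v

  -- Charged to the likely value only, so that the two rarities of a coordinate add up to min(p, 1 -
  -- p).
  rarity : Bool → Carrier → Carrier
  rarity v p = if likely p v then 1# - likelihood v p else 0#

  rarity-value : ∀ {b} v p → likely p v ≡ b → rarity v p ≈ (if b then 1# - likelihood v p else 0#)
  rarity-value v p eq = ≡⇒≈ (≡.cong (λ b → if b then 1# - likelihood v p else 0#) eq)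

  lift : ∀ {d} → List (Mask d) → List (Mask (suc d))
  lift = map (false ∷_)

  length-lift : ∀ {d} (Bs : List (Mask d)) → fromℕ (length Bs) ≈ fromℕ (length (lift Bs))
  length-lift Bs = ≡⇒≈ (≡.cong fromℕ (≡.sym (List.length-map _ Bs)))

  likely⇒≥½ : ∀ p v → likely p v ≡ true → 1# ≤ fromℕ 2 * likelihood v p
  likely⇒≥½ p v eq with total p (1# - p)
  likely⇒≥½ p true eq | inj₁ p≤ = ≤-from-gap (gap p≤)
    (solve 1 (λ p → :ℕ 2 :* (:1 :- p) := :1 :+ (:1 :- p :- p)) refl p)
  likely⇒≥½ p false eq | inj₂ p≥ = ≤-from-gap (gap p≥)
    (solve 1 (λ p → :ℕ 2 :* p := :1 :+ (p :- (:1 :- p))) refl p)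

  ⊓≤rarities : ∀ p → p ⊓ (1# - p) ≤ rarity false p + rarity true p
  ⊓≤rarities p with total p (1# - p)
  ... | inj₁ _ = reflexive (solve 1 (λ p → p := :0 :+ (:1 :- (:1 :- p))) refl p)
  ... | inj₂ _ = reflexive (solve 1 (λ p → :1 :- p := :1 :- p :+ :0) refl p)

  blockMass-none : ∀ v {d} (μ : Fin d → Carrier) → blockMass v none μ ≡ 1#
  blockMass-none v {zero} μ = ≡.refl
  blockMass-none v {suc d} μ = blockMass-none v (μ ∘ Fin.suc)

  -- The invariant of the greedy algorithm, which closes a block as soon as its mass
  -- is at most 1/2.  The slack is the total rarity of the unfinished block rest; it
  -- is bounded because Π (1 - pᵣ) · (1 + Σ pᵣ) ≤ 1.
  record Packing (v : Bool) {d} (μ : Fin d → Carrier) : Set (c Level.⊔ ℓ₂) where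
    field
      blocks         : List (Mask d)
      disjoint       : AllPairs Disjoint blocks
      balanced       : All (Balanced v μ) blocks
      rest           : Mask d
      rest-disjoint  : All (Disjoint rest) blocks
      rest≥½         : 1# ≤ fromℕ 2 * blockMass v rest μ
      slack          : Carrier
      0≤slack        : 0# ≤ slack
      slack-bound    : blockMass v rest μ * (1# + slack) ≤ 1#
      rarity-bound   : sum (λ r → rarity v (μ r)) ≤ fromℕ 3 * fromℕ (length blocks) + slack

  pack : ∀ v {d} (μ : Fin d → Carrier) → (∀ r → InUnitInterval (μ r)) → Packing v μ
  pack v {zero} μ μ∈ = record
    { blocks = []
    ; disjoint = []
    ; balanced = []
    ; rest = []
    ; rest-disjoint = []
    ; rest≥½ = ≤-from-gap 0≤1 (solve 0 (:ℕ 2 :* :1 := :1 :+ :1) refl)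
    ; slack = 0#
    ; 0≤slack = ≤-refl
    ; slack-bound = reflexive (solve 0 (:1 :* (:1 :+ :0) := :1) refl)
    ; rarity-bound = reflexive (solve 0 (:0 := :ℕ 3 :* :0 :+ :0) refl)
    }
  pack v {suc d} μ μ∈ with likely (μ Fin.zero) v in eq
  ... | false = record
    { blocks = lift blocks
    ; disjoint = AllPairs.map⁺ (AllPairs.map (≡.refl ∷_) disjoint)
    ; balanced = All.map⁺ (All.map (λ β → record { Balanced β }) balanced)
    ; rest = false ∷ rest
    ; rest-disjoint = All.map⁺ (All.map (≡.refl ∷_) rest-disjoint)
    ; rest≥½ = rest≥½
    ; slack = slack
    ; 0≤slack = 0≤slack
    ; slack-bound = slack-bound
    ; rarity-bound = bound
    }
    where
    open Packing (pack v (μ ∘ Fin.suc) (μ∈ ∘ Fin.suc))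
    bound : sum (λ r → rarity v (μ r)) ≤ fromℕ 3 * fromℕ (length (lift blocks)) + slack
    bound = ≤-respˡ-≈ (trans (solve 1 (λ x → x := :0 :+ x) refl _)
        (+-congʳ (sym (rarity-value v (μ Fin.zero) eq))))
      (≤-respʳ-≈ (+-congʳ (*-congˡ (length-lift blocks))) rarity-bound)
  ... | true = extend (total (fromℕ 2 * (w * m)) 1#)
    where
    open Packing (pack v (μ ∘ Fin.suc) (μ∈ ∘ Fin.suc))
    w = likelihood v (μ Fin.zero)
    m = blockMass v rest (μ ∘ Fin.suc)
    slack′ = (1# - w) + slack

    0≤1-w : 0# ≤ 1# - w
    0≤1-w = gap (proj₂ (likelihood-unit v (μ∈ Fin.zero)))

    0≤slack′ : 0# ≤ slack′
    0≤slack′ = 0≤1-w +⁺ 0≤slack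

    0≤2m : 0# ≤ fromℕ 2 * m
    0≤2m = ≤-trans 0≤1 rest≥½

    0≤m : 0# ≤ m
    0≤m = *-cancelˡ-≤ 1 (≤-respˡ-≈ (solve 0 (:0 := :ℕ 2 :* :0) refl) 0≤2m)

    -- Both factors are at least 1/2, so a block whose mass drops below 1/2 still keeps 1/4.
    4wm≥1 : 1# ≤ fromℕ 4 * (w * m)
    4wm≥1 = ≤-from-gap (gap (likely⇒≥½ (μ Fin.zero) v eq) *⁺ 0≤2m +⁺ gap rest≥½)
      (solve 2 (λ w m → :ℕ 4 :* (w :* m) := :1
          :+ ((:ℕ 2 :* w :- :1) :* (:ℕ 2 :* m) :+ (:ℕ 2 :* m :- :1))) refl w m)

    -- With p = 1 - w and s the old slack: (1 - p)(1 + p + s) = 1 + s - p(p + s).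
    slack′-bound : w * m * (1# + slack′) ≤ 1#
    slack′-bound = ≤-from-gap (gap slack-bound +⁺ 0≤m *⁺ (0≤1-w *⁺ 0≤slack′))
      (solve 3 (λ w m s → :1 := w :* m :* (:1 :+ ((:1 :- w) :+ s))
          :+ (:1 :- m :* (:1 :+ s) :+ m :* ((:1 :- w) :* ((:1 :- w) :+ s)))) refl w m slack)

    -- 1 + `slack′` is at most the inverse of the mass, hence at most 4; this is the 3 charged to
    -- each block.
    slack′≤3 : slack′ ≤ fromℕ 3
    slack′≤3 = ≤-from-gap (0≤fromℕ 4 *⁺ gap slack′-bound +⁺ gap 4wm≥1 *⁺ (0≤1 +⁺ 0≤slack′))
      (solve 2 (λ m s → :ℕ 3 := s :+ (:ℕ 4 :* (:1 :- m :* (:1 :+ s)) :+ (:ℕ 4 :* m :- :1) :*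
          (:1 :+ s))) refl (w * m) slack′)

    bound : sum (λ r → rarity v (μ r)) ≤ fromℕ 3 * fromℕ (length blocks) + slack′
    bound = ≤-respˡ-≈ (+-congʳ (sym (rarity-value v (μ Fin.zero) eq)))
        (≤-from-gap (gap rarity-bound)
      (solve 4 (λ w s n x → :ℕ 3 :* n :+ ((:1 :- w) :+ s) := (:1 :- w) :+ x
          :+ (:ℕ 3 :* n :+ s :- x)) refl w slack (fromℕ (length blocks)) _))

    extend : fromℕ 2 * (w * m) ≤ 1# ⊎ 1# ≤ fromℕ 2 * (w * m) → Packing v μ
    -- The block is closed and pays for its slack; the next one starts empty.
    extend (inj₁ ≤½) = record
      { blocks = (true ∷ rest) ∷ lift blocks
      ; disjoint = All.map⁺ (All.map (≡.refl ∷_) rest-disjoint)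
                   ∷ AllPairs.map⁺ (AllPairs.map (≡.refl ∷_) disjoint)
      ; balanced = record { mass≥¼ = 4wm≥1 ; mass≤½ = ≤½ }
                   ∷ All.map⁺ (All.map (λ β → record { Balanced β }) balanced)
      ; rest = none
      ; rest-disjoint = All.universal none-disjoint _
      ; rest≥½ = none≥½
      ; slack = 0#
      ; 0≤slack = ≤-refl
      ; slack-bound = none-bound
      ; rarity-bound = ≤-trans bound closed-bound
      }
      where
      none≥½ : 1# ≤ fromℕ 2 * blockMass v none μ
      none≥½ rewrite blockMass-none v μ = ≤-from-gap 0≤1 (solve 0 (:ℕ 2 :* :1 := :1 :+ :1) refl)
      none-bound : blockMass v none μ * (1# + 0#) ≤ 1#
      none-bound rewrite blockMass-none v μ = reflexive (solve 0 (:1 :* (:1 :+ :0) := :1) refl)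
      closed-bound : fromℕ 3 * fromℕ (length blocks) + slack′
                     ≤ fromℕ 3 * fromℕ (suc (length (lift blocks))) + 0#
      closed-bound = ≤-from-gap (gap slack′≤3)
          (trans (+-congʳ (*-congˡ (+-congˡ (sym (length-lift blocks)))))
        (solve 2 (λ n s → :ℕ 3 :* (:1 :+ n) :+ :0 := :ℕ 3 :* n :+ s :+ (:ℕ 3 :- s)) refl
            (fromℕ (length blocks)) slack′))
    extend (inj₂ ≥½) = record
      { blocks = lift blocks
      ; disjoint = AllPairs.map⁺ (AllPairs.map (≡.refl ∷_) disjoint)
      ; balanced = All.map⁺ (All.map (λ β → record { Balanced β }) balanced)
      ; rest = true ∷ rest
      ; rest-disjoint = All.map⁺ (All.map (≡.refl ∷_) rest-disjoint)
      ; rest≥½ = ≥½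
      ; slack = slack′
      ; 0≤slack = 0≤slack′
      ; slack-bound = slack′-bound
      ; rarity-bound = ≤-respʳ-≈ (+-congʳ (*-congˡ (length-lift blocks))) bound
      }

  -- The open block has mass at least 1/2, so 1 + `slack` is at most 2: it costs only an additive
  -- constant.
  slack≤1 : ∀ {v d} {μ : Fin d → Carrier} (P : Packing v μ) → Packing.slack P ≤ 1#
  slack≤1 {v} {μ = μ} P = ≤-from-gap (0≤fromℕ 2 *⁺ gap slack-bound +⁺ gap rest≥½ *⁺
      (0≤1 +⁺ 0≤slack))
    (solve 2 (λ m s → :1 := s :+ (:ℕ 2 :* (:1 :- m :* (:1 :+ s)) :+ (:ℕ 2 :* m :- :1) :* (:1 :+ s)))
        refl (blockMass v rest μ) slack)
    where open Packing P

  -- The bound on the number of queries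

  module _ {d q} {μ : Fin d → Carrier} (μ∈ : ∀ r → InUnitInterval (μ r))
           {ε} (ε≤⅒ : fromℕ 10 * ε ≤ 1#)
           {A : Algorithm d q} (tester : IsMonotonicityTester μ ε A) where
    open IsMonotonicityTester tester

    private
      -- All swaps together then cost at most (2^d - 1)/K, below 1/12.
      k = 12 ℕ.* 2 ℕ.^ d
      ⅓ = reciprocal 2
    open Averaging k

    private
      instance-of : Seed K d → Cube d → ℕ
      instance-of s = hard 0 s none

    12cost≤1 : fromℕ 12 * cost d ≤ 1#
    12cost≤1 = ≤-trans (*-monoˡ-≤ (0≤fromℕ 12) (≤-from-gap (0≤reciprocal k) refl))
      (≤-trans (reflexive (trans (*-congˡ (cost+u d))
          (trans (solve 3 (λ a b u → a :* (b :* u) := (a :* b) :* u) refl (fromℕ 12)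
              (fromℕ (2 ℕ.^ d)) u)
            (*-congʳ (sym (×1-homo-* 12 (2 ℕ.^ d)))))))
        (≤-respʳ-≈ (reciprocal-inverse k)
          (≤-from-gap (0≤reciprocal k) (solve 2 (λ n u → (:1 :+ n) :* u := n :* u :+ u) refl
              (fromℕ k) u))))

    reject-monotone : ∀ (s : Seed K d) → outputProb A (instance-of s) false ≤ ⅓
    reject-monotone s = *-cancelˡ-≤ 2
        (≤-from-gap (gap (proj₁ (accepts (instance-of s) (hard-monotone 0 s))))
      (trans (reciprocal-inverse 2) (trans (solve 0 (:1 := :ℕ 3 :* :1 :- :ℕ 2) refl)
        (trans (+-congʳ (*-congˡ (sym (outputProb-total A (instance-of s)))))
          (solve 2 (λ x y → :ℕ 3 :* (x :+ y) :- :ℕ 2 := :ℕ 3 :* y :+ (:ℕ 3 :* x :- :ℕ 2))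
            refl _ _)))))

    module _ (v : Bool) where

      reject-far : ∀ {B} (s : Seed K d) → Balanced v μ B → ⅓ + ⅓ ≤ outputProb A (hard 0 s B) false
      reject-far {B} s balanced = *-cancelˡ-≤ 2 (≤-trans (reflexive
        (trans (solve 1 (λ t → :ℕ 3 :* (t :+ t) := :ℕ 3 :* t :+ :ℕ 3 :* t) refl ⅓)
          (trans (+-cong (reciprocal-inverse 2) (reciprocal-inverse 2))
              (solve 0 (:1 :+ :1 := :ℕ 2) refl))))
        (proj₁ (rejects (hard 0 s B) (hard-far v s μ∈ balanced ε≤⅒))))

      -- Rejection has probability at least 2/3 on the flipped functions and at most 1/3 on the
      -- monotone ones; unflipping costs at most 1/12, which leaves 2/3 - 1/3 - 1/12 = 1/4 for
      -- separations.
      capture≥¼ : ∀ {B} → Balanced v μ B →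
                  1# ≤ fromℕ 4 * 𝔼 (λ s → watch never B [] A (instance-of s))
      capture≥¼ {B} balanced = arithmetic (reciprocal-inverse 2) 12cost≤1
        (≤-trans (≤-respˡ-≈ (𝔼-const {d} _) (𝔼-mono λ s → ≤-trans (reject-far s balanced)
            (reject≤watch B [] A _)))
          (≤-trans (flip-none 0 B (watch rejection B [] A)
              (λ f → watch-nonneg rejection∈[0,1] B [] A f , watch≤1 rejection∈[0,1] B [] A f)
              (watch-modular rejection B [] A))
            (+-mono-≤ (𝔼-bound ⅓ λ s → ≤-trans (watch≤reject+capture B [] A (instance-of s))
              (≤-trans (+-mono-≤ (reject-monotone s) ≤-refl)
                  (reflexive (solve 2 (λ x y → x :+ y := y :+ x) refl _ _)))) ≤-refl)))
        where
        arithmetic : ∀ {t c x} → fromℕ 3 * t ≈ 1# → fromℕ 12 * c ≤ 1# → t + t ≤ x + t + c →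
            1# ≤ fromℕ 4 * x
        arithmetic {t} {c} {x} 3t 12c h = *-cancelˡ-≤ 2 (≤-from-gap (0≤fromℕ 12 *⁺ gap h +⁺ gap 12c)
          (trans (solve 3 (λ t c x → :ℕ 3 :* (:ℕ 4 :* x) :=
              (:ℕ 4 :* (:ℕ 3 :* t) :- :1) :+ (:ℕ 12 :* ((x :+ t :+ c) :- (t :+ t))
                  :+ (:1 :- :ℕ 12 :* c))) refl t c x)
            (+-congʳ (trans (+-congʳ (*-congˡ 3t))
                (solve 0 (:ℕ 4 :* :1 :- :1 := :ℕ 3 :* :1) refl)))))

      -- All blocks are watched on the same monotone functions, so the separation probabilities add
      -- up inside the expectation, where `capture-count` bounds them by `q` for each seed.
      few-blocks : ∀ {Bs} → AllPairs Disjoint Bs → All (Balanced v μ) Bs →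
                   fromℕ (length Bs) ≤ fromℕ 4 * fromℕ q
      few-blocks {Bs} disjoint balanced = ≤-trans (count balanced)
        (*-monoˡ-≤ (0≤fromℕ 4)
            (≤-trans (reflexive (𝔼-∑ {d} Bs (λ B s → watch never B [] A (instance-of s))))
          (≤-respʳ-≈ (𝔼-const {d} _) (𝔼-mono λ s → capture-count A (instance-of s) [] Bs disjoint
              (All.universal (λ B _ _ ()) Bs)))))
        where
        count : ∀ {Bs} → All (Balanced v μ) Bs →
                fromℕ (length Bs) ≤ fromℕ 4 * ∑ Bs (λ B → 𝔼 (λ s → watch never B [] A (instance-of s)))
        count [] = reflexive (solve 0 (:0 := :ℕ 4 :* :0) refl)
        count (β ∷ βs) = ≤-trans (+-mono-≤ (capture≥¼ β) (count βs))
          (reflexive (solve 2 (λ x y → :ℕ 4 :* x :+ :ℕ 4 :* y := :ℕ 4 :* (x :+ y)) refl _ _))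

    -- At most 4q blocks for each `v`, at 3 apiece plus a slack of 1, bound the sum by 24q + 2; the
    -- threshold 4 makes this 2 at most half of the sum, hence the factor 48.
    query-bound : fromℕ 4 ≤ Σmin μ → Σmin μ ≤ fromℕ 48 * fromℕ q
    query-bound 4≤S = arithmetic (few-blocks false P₀.disjoint P₀.balanced)
        (few-blocks true P₁.disjoint P₁.balanced)
      (≤-trans (sum-mono (⊓≤rarities ∘ μ))
          (≤-trans (reflexive (sum-+ (rarity false ∘ μ) (rarity true ∘ μ)))
        (+-mono-≤ (≤-trans P₀.rarity-bound (+-mono-≤ ≤-refl (slack≤1 packing₀)))
            (≤-trans P₁.rarity-bound (+-mono-≤ ≤-refl (slack≤1 packing₁))))))
      4≤S
      where
      packing₀ = pack false μ μ∈
      packing₁ = pack true μ μ∈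
      module P₀ = Packing packing₀
      module P₁ = Packing packing₁
      arithmetic : ∀ {a b q S} → a ≤ fromℕ 4 * q → b ≤ fromℕ 4 * q →
        S ≤ (fromℕ 3 * a + 1#) + (fromℕ 3 * b + 1#) → fromℕ 4 ≤ S → S ≤ fromℕ 48 * q
      arithmetic {a} {b} {q} {S} p₀ p₁ p₂ p₃ =
        ≤-from-gap (0≤fromℕ 6 *⁺ gap p₀ +⁺ 0≤fromℕ 6 *⁺ gap p₁ +⁺ 0≤fromℕ 2 *⁺ gap p₂ +⁺ gap p₃)
        (solve 4 (λ a b q S → :ℕ 48 :* q := S
            :+ (:ℕ 6 :* (:ℕ 4 :* q :- a) :+ :ℕ 6 :* (:ℕ 4 :* q :- b)
          :+ :ℕ 2 :* ((:ℕ 3 :* a :+ :1) :+ (:ℕ 3 :* b :+ :1) :- S) :+ (S :- :ℕ 4))) refl a b q S)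

theorem5p11 : ∀ {c ℓ₁ ℓ₂} (F : OrderedField c ℓ₁ ℓ₂) →
    let open OrderedField F
        open Testing F
    in ∃₂ λ (C S₀ : ℕ) →
       ∀ (d : ℕ) (μ : Fin d → Carrier) → (∀ r → InUnitInterval (μ r)) →
       ∀ (ε : Carrier) → fromℕ 10 * ε ≤ 1# →
       ∀ (q : ℕ) (A : Algorithm d q) → IsMonotonicityTester μ ε A →
       fromℕ S₀ ≤ Σmin μ → Σmin μ ≤ fromℕ C * fromℕ q
theorem5p11 F = 48 , 4 , λ d μ μ∈ ε ε≤⅒ q A tester → LowerBound.query-bound F μ∈ ε≤⅒ tester
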